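{- Let $0\leq \alpha < 1$ and let $G$ be a connected graph with $n$ vertices and $m$ edges. Let $1\leq k\leq n$ and let $U=\{u_1,\ldots,u_{k-1}\}\subseteq V(G)$ be any set of $k-1$ vertices (empty if $k=1$). Then $$S_{k}(A_{\alpha}(G)) \geq \left(\alpha-\frac{1}{n-k+1}\right)\sum_{u\in U}d_u+\frac{2m-(1-\alpha)|\partial(U, V(G)\setminus U)|}{n-k+1}.$$
   Context: All graphs are simple and undirected. $d_u$ is the degree of vertex $u$. $A_{\alpha}(G)=\alpha D(G)+(1-\alpha)A(G)$, where $A(G)$ is the adjacency matrix and $D(G)$ the diagonal degree matrix. For a real symmetric matrix $M$ with eigenvalues $\lambda_1(M)\geq\cdots\geq\lambda_n(M)$, $S_k(M)=\sum_{i=1}^k\lambda_i(M)$. For $U,W\subseteq V(G)$, $\partial(U,W)$ is the set of edges joining a vertex of $U$ with a vertex of $W$. -}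

module Defs where

open import Algebra.Bundles.Raw using (RawRing)
import Algebra.Definitions.RawSemiring as RawSemiringDefs
open import Data.Bool.Base using (if_then_else_)
open import Data.Fin.Base as Fin using (Fin; zero; suc; toℕ; inject≤; punchIn)
import Data.Fin.Properties as Fin
open import Data.Fin.Subset using (Subset; _∈_)
open import Data.Fin.Subset.Properties using (_∈?_)
open import Data.Integer.Base using (+_)
open import Data.List.Base as List using (List; length; filter; allFin; cartesianProduct)
open import Data.Nat.Base as ℕ using (ℕ; zero; suc)
import Data.Nat.ListAction as ListAction
import Data.Nat.Properties as ℕ
open import Data.Product.Base using (∃; _×_; _,_; proj₁; proj₂)
open import Data.Rational.Base as ℚ using (ℚ; 0ℚ; 1ℚ)
import Data.Rational.Properties as ℚ
open import Data.Rational.Solver using (module +-*-Solver)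
open import Data.Sum.Base using (_⊎_)
open import Level using (0ℓ)
open import Relation.Binary.Construct.Closure.ReflexiveTransitive using (Star)
open import Relation.Binary.Core using (Rel)
open import Relation.Binary.Definitions using (Decidable; Symmetric; Irreflexive)
open import Relation.Binary.PropositionalEquality
  using (_≡_; refl; sym; trans; cong; cong₂; subst)
open import Relation.Nullary.Decidable using (does; _×-dec_; _⊎-dec_)

------------------------------------------------------------------------
-- Real numbers: Cauchy sequences of rationals, as a setoid

IsCauchy : (ℕ → ℚ) → Set
IsCauchy x = ∀ ε → 0ℚ ℚ.< ε →
  ∃ λ N → ∀ m n → N ℕ.≤ m → N ℕ.≤ n → ℚ.∣ x m ℚ.- x n ∣ ℚ.≤ ε

record ℝ : Set where
  constructor mkℝ
  field
    seq    : ℕ → ℚ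
    cauchy : IsCauchy seq

open ℝ public

infix 4 _≈_ _≤_ _<_

_≈_ : Rel ℝ 0ℓ
x ≈ y = ∀ ε → 0ℚ ℚ.< ε → ∃ λ N → ∀ n → N ℕ.≤ n → ℚ.∣ seq x n ℚ.- seq y n ∣ ℚ.≤ ε

_≤_ : Rel ℝ 0ℓ
x ≤ y = ∀ ε → 0ℚ ℚ.< ε → ∃ λ N → ∀ n → N ℕ.≤ n → seq x n ℚ.≤ seq y n ℚ.+ ε

_<_ : Rel ℝ 0ℓ
x < y = ∃ λ ε → 0ℚ ℚ.< ε × ∃ λ N → ∀ n → N ℕ.≤ n → seq x n ℚ.+ ε ℚ.≤ seq y n

fromℚ : ℚ → ℝ
fromℚ q = mkℝ (λ _ → q) λ ε 0<ε → 0 , λ _ _ _ _ →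
  subst (λ d → ℚ.∣ d ∣ ℚ.≤ ε) (sym (ℚ.+-inverseʳ q)) (ℚ.<⇒≤ 0<ε)

abstract
  ½-pos : ∀ {ε} → 0ℚ ℚ.< ε → 0ℚ ℚ.< ℚ.½ ℚ.* ε
  ½-pos = ℚ.*-monoʳ-<-pos ℚ.½

  ½+½ : ∀ ε → ℚ.½ ℚ.* ε ℚ.+ ℚ.½ ℚ.* ε ≡ ε
  ½+½ ε = trans (sym (ℚ.*-distribʳ-+ ε ℚ.½ ℚ.½)) (ℚ.*-identityˡ ε)

  +-cauchy : ∀ x y → IsCauchy x → IsCauchy y → IsCauchy (λ n → x n ℚ.+ y n)
  +-cauchy x y cx cy ε 0<ε =
    let (M , p) = cx (ℚ.½ ℚ.* ε) (½-pos 0<ε)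
        (N , q) = cy (ℚ.½ ℚ.* ε) (½-pos 0<ε)
    in M ℕ.⊔ N , λ m n b c → begin
      ℚ.∣ (x m ℚ.+ y m) ℚ.- (x n ℚ.+ y n) ∣
        ≡⟨ cong ℚ.∣_∣ (rearrange (x m) (y m) (x n) (y n)) ⟩
      ℚ.∣ (x m ℚ.- x n) ℚ.+ (y m ℚ.- y n) ∣
        ≤⟨ ℚ.∣p+q∣≤∣p∣+∣q∣ (x m ℚ.- x n) (y m ℚ.- y n) ⟩
      ℚ.∣ x m ℚ.- x n ∣ ℚ.+ ℚ.∣ y m ℚ.- y n ∣
        ≤⟨ ℚ.+-mono-≤ (p m n (ℕ.m⊔n≤o⇒m≤o M N b) (ℕ.m⊔n≤o⇒m≤o M N c))
                      (q m n (ℕ.m⊔n≤o⇒n≤o M N b) (ℕ.m⊔n≤o⇒n≤o M N c)) ⟩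
      ℚ.½ ℚ.* ε ℚ.+ ℚ.½ ℚ.* ε
        ≡⟨ ½+½ ε ⟩
      ε ∎
    where
    open ℚ.≤-Reasoning
    open +-*-Solver
    rearrange : ∀ a b c d → (a ℚ.+ b) ℚ.- (c ℚ.+ d) ≡ (a ℚ.- c) ℚ.+ (b ℚ.- d)
    rearrange = solve 4 (λ a b c d →
      (a :+ b) :- (c :+ d) := (a :- c) :+ (b :- d)) refl

  neg-cauchy : ∀ x → IsCauchy x → IsCauchy (λ n → ℚ.- x n)
  neg-cauchy x cx ε 0<ε =
    let (N , p) = cx ε 0<ε
    in N , λ m n b c →
      subst (ℚ._≤ ε)
        (sym (trans (cong ℚ.∣_∣ (sym (ℚ.neg-distrib-+ (x m) (ℚ.- x n))))
                    (ℚ.∣-p∣≡∣p∣ (x m ℚ.- x n))))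
        (p m n b c)

  eventuallyBounded : ∀ x → IsCauchy x →
    ∃ λ B → 0ℚ ℚ.< B × ∃ λ N → ∀ n → N ℕ.≤ n → ℚ.∣ x n ∣ ℚ.≤ B
  eventuallyBounded x cx =
    let (N , p) = cx 1ℚ (ℚ.positive⁻¹ 1ℚ)
    in 1ℚ ℚ.+ ℚ.∣ x N ∣
     , ℚ.+-mono-<-≤ (ℚ.positive⁻¹ 1ℚ) (ℚ.0≤∣p∣ (x N))
     , N , λ n b → begin
         ℚ.∣ x n ∣                        ≡⟨ cong ℚ.∣_∣ (split (x n) (x N)) ⟩
         ℚ.∣ (x n ℚ.- x N) ℚ.+ x N ∣      ≤⟨ ℚ.∣p+q∣≤∣p∣+∣q∣ (x n ℚ.- x N) (x N) ⟩
         ℚ.∣ x n ℚ.- x N ∣ ℚ.+ ℚ.∣ x N ∣  ≤⟨ ℚ.+-monoˡ-≤ ℚ.∣ x N ∣ (p n N b ℕ.≤-refl) ⟩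
         1ℚ ℚ.+ ℚ.∣ x N ∣                 ∎
    where
    open ℚ.≤-Reasoning
    open +-*-Solver
    split : ∀ a b → a ≡ (a ℚ.- b) ℚ.+ b
    split = solve 2 (λ a b → a := (a :- b) :+ b) refl

  *-mono-≤-nonNeg : ∀ p q r s → 0ℚ ℚ.≤ r → 0ℚ ℚ.≤ q → p ℚ.≤ q → r ℚ.≤ s →
                    p ℚ.* r ℚ.≤ q ℚ.* s
  *-mono-≤-nonNeg p q r s 0≤r 0≤q p≤q r≤s = ℚ.≤-trans
    (ℚ.*-monoʳ-≤-nonNeg r {{ℚ.nonNegative 0≤r}} p≤q)
    (ℚ.*-monoˡ-≤-nonNeg q {{ℚ.nonNegative 0≤q}} r≤s)

  *-cauchy : ∀ x y → IsCauchy x → IsCauchy y → IsCauchy (λ n → x n ℚ.* y n)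
  *-cauchy x y cx cy ε 0<ε =
    let (A , 0<A , K , a) = eventuallyBounded x cx
        (B , 0<B , L , b) = eventuallyBounded y cy
        C     = A ℚ.+ B
        C-pos = ℚ.positive (ℚ.+-mono-< 0<A 0<B)
        C≢0   = ℚ.pos⇒nonZero C {{C-pos}}
        1/C   = (ℚ.1/ C) {{C≢0}}
        δ     = 1/C ℚ.* ε
        0<δ   = subst (ℚ._< δ) (ℚ.*-zeroʳ 1/C)
                  (ℚ.*-monoʳ-<-pos 1/C {{ℚ.1/pos⇒pos C {{C-pos}}}} 0<ε)
        (M , p) = cx δ 0<δ
        (N , q) = cy δ 0<δ
    in (K ℕ.⊔ L) ℕ.⊔ (M ℕ.⊔ N) , λ m n u v →
       let u₁ = ℕ.m⊔n≤o⇒m≤o (K ℕ.⊔ L) (M ℕ.⊔ N) u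
           u₂ = ℕ.m⊔n≤o⇒n≤o (K ℕ.⊔ L) (M ℕ.⊔ N) u
           v₁ = ℕ.m⊔n≤o⇒m≤o (K ℕ.⊔ L) (M ℕ.⊔ N) v
           v₂ = ℕ.m⊔n≤o⇒n≤o (K ℕ.⊔ L) (M ℕ.⊔ N) v
       in begin
      ℚ.∣ x m ℚ.* y m ℚ.- x n ℚ.* y n ∣
        ≡⟨ cong ℚ.∣_∣ (rearrange (x m) (y m) (x n) (y n)) ⟩
      ℚ.∣ x m ℚ.* (y m ℚ.- y n) ℚ.+ y n ℚ.* (x m ℚ.- x n) ∣
        ≤⟨ ℚ.∣p+q∣≤∣p∣+∣q∣ (x m ℚ.* (y m ℚ.- y n)) (y n ℚ.* (x m ℚ.- x n)) ⟩
      ℚ.∣ x m ℚ.* (y m ℚ.- y n) ∣ ℚ.+ ℚ.∣ y n ℚ.* (x m ℚ.- x n) ∣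
        ≡⟨ cong₂ ℚ._+_ (ℚ.∣p*q∣≡∣p∣*∣q∣ (x m) (y m ℚ.- y n))
                       (ℚ.∣p*q∣≡∣p∣*∣q∣ (y n) (x m ℚ.- x n)) ⟩
      ℚ.∣ x m ∣ ℚ.* ℚ.∣ y m ℚ.- y n ∣ ℚ.+ ℚ.∣ y n ∣ ℚ.* ℚ.∣ x m ℚ.- x n ∣
        ≤⟨ ℚ.+-mono-≤
             (*-mono-≤-nonNeg ℚ.∣ x m ∣ A ℚ.∣ y m ℚ.- y n ∣ δ (ℚ.0≤∣p∣ (y m ℚ.- y n)) (ℚ.<⇒≤ 0<A)
               (a m (ℕ.m⊔n≤o⇒m≤o K L u₁))
               (q m n (ℕ.m⊔n≤o⇒n≤o M N u₂) (ℕ.m⊔n≤o⇒n≤o M N v₂)))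
             (*-mono-≤-nonNeg ℚ.∣ y n ∣ B ℚ.∣ x m ℚ.- x n ∣ δ (ℚ.0≤∣p∣ (x m ℚ.- x n)) (ℚ.<⇒≤ 0<B)
               (b n (ℕ.m⊔n≤o⇒n≤o K L v₁))
               (p m n (ℕ.m⊔n≤o⇒m≤o M N u₂) (ℕ.m⊔n≤o⇒m≤o M N v₂))) ⟩
      A ℚ.* δ ℚ.+ B ℚ.* δ
        ≡⟨ ℚ.*-distribʳ-+ δ A B ⟨
      C ℚ.* (1/C ℚ.* ε)
        ≡⟨ ℚ.*-assoc C 1/C ε ⟨
      (C ℚ.* 1/C) ℚ.* ε
        ≡⟨ cong (ℚ._* ε) (ℚ.*-inverseʳ C {{C≢0}}) ⟩
      1ℚ ℚ.* ε
        ≡⟨ ℚ.*-identityˡ ε ⟩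
      ε ∎
    where
    open ℚ.≤-Reasoning
    open +-*-Solver
    rearrange : ∀ a b c d →
      a ℚ.* b ℚ.- c ℚ.* d ≡ a ℚ.* (b ℚ.- d) ℚ.+ d ℚ.* (a ℚ.- c)
    rearrange = solve 4 (λ a b c d →
      a :* b :- c :* d := a :* (b :- d) :+ d :* (a :- c)) refl

infix  8 -_
infixl 7 _*_
infixl 6 _+_ _-_

_+_ : ℝ → ℝ → ℝ
x + y = mkℝ (λ n → seq x n ℚ.+ seq y n) (+-cauchy (seq x) (seq y) (cauchy x) (cauchy y))

_*_ : ℝ → ℝ → ℝ
x * y = mkℝ (λ n → seq x n ℚ.* seq y n) (*-cauchy (seq x) (seq y) (cauchy x) (cauchy y))

-_ : ℝ → ℝ
- x = mkℝ (λ n → ℚ.- seq x n) (neg-cauchy (seq x) (cauchy x))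

_-_ : ℝ → ℝ → ℝ
x - y = x + (- y)

0ℝ 1ℝ : ℝ
0ℝ = fromℚ 0ℚ
1ℝ = fromℚ 1ℚ

fromℕ : ℕ → ℝ
fromℕ m = fromℚ (+ m ℚ./ 1)

1/ℕ_ : (m : ℕ) → .{{ℕ.NonZero m}} → ℝ
1/ℕ m = fromℚ (+ 1 ℚ./ m)

ℝ-rawRing : RawRing 0ℓ 0ℓ
ℝ-rawRing = record
  { Carrier = ℝ ; _≈_ = _≈_ ; _+_ = _+_ ; _*_ = _*_ ; -_ = -_ ; 0# = 0ℝ ; 1# = 1ℝ }

open RawSemiringDefs (RawRing.rawSemiring ℝ-rawRing) public using (sum; product; _^_)

------------------------------------------------------------------------
-- Matrices and eigenvalues

Matrix : ℕ → Set
Matrix n = Fin n → Fin n → ℝ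

-- Laplace expansion along the first row.
det : ∀ {n} → Matrix n → ℝ
det {zero}  M = 1ℝ
det {suc n} M = sum λ j →
  ((- 1ℝ) ^ toℕ j) * (M zero j * det λ r c → M (suc r) (punchIn j c))

δ : ∀ {n} → Matrix n
δ i j = if does (i Fin.≟ j) then 1ℝ else 0ℝ

charPoly : ∀ {n} → Matrix n → ℝ → ℝ
charPoly M t = det λ i j → t * δ i j - M i j

-- ev lists the eigenvalues of M with (algebraic) multiplicity, in
-- non-increasing order.  A real symmetric matrix has such a list, and
-- it is unique up to _≈_.
record IsSpectrum {n} (M : Matrix n) (ev : Fin n → ℝ) : Set where
  field
    descending : ∀ i j → i Fin.≤ j → ev j ≤ ev i
    roots      : ∀ t → charPoly M t ≈ product (λ i → t - ev i)

-- Sum of the first k entries; S_k(M) when ev is the spectrum of M.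
S : ∀ {n k} → k ℕ.≤ n → (Fin n → ℝ) → ℝ
S k≤n ev = sum λ i → ev (inject≤ i k≤n)

------------------------------------------------------------------------
-- Finite simple graphs on the vertex set Fin n

record Graph (n : ℕ) : Set₁ where
  field
    Adj        : Rel (Fin n) 0ℓ
    adj?       : Decidable Adj
    adj-sym    : Symmetric Adj
    adj-irrefl : Irreflexive _≡_ Adj

module _ {n} (G : Graph n) where
  open Graph G

  Connected : Set
  Connected = ∀ u v → Star Adj u v

  degree : Fin n → ℕ
  degree u = length (filter (adj? u) (allFin n))

  -- An edge {u,v} is represented by the pair (u , v) with u < v.
  edges : List (Fin n × Fin n)
  edges = filter (λ (u , v) → (u Fin.<? v) ×-dec adj? u v)
                 (cartesianProduct (allFin n) (allFin n))

  numEdges : ℕ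
  numEdges = length edges

  ∂ : Subset n → Subset n → List (Fin n × Fin n)
  ∂ U W = filter (λ (u , v) → ((u ∈? U) ×-dec (v ∈? W)) ⊎-dec ((v ∈? U) ×-dec (u ∈? W)))
                 edges

  degreeSum : Subset n → ℕ
  degreeSum U = ListAction.sum (List.map degree (filter (_∈? U) (allFin n)))

  adjacencyMatrix : Matrix n
  adjacencyMatrix u v = if does (adj? u v) then 1ℝ else 0ℝ

  degreeMatrix : Matrix n
  degreeMatrix u v = fromℕ (degree u) * δ u v

  Aα : ℝ → Matrix n
  Aα α u v = α * degreeMatrix u v + (1ℝ - α) * adjacencyMatrix u v

{-# OPTIONS --safe #-}

-- By Ky Fan's inequality, trace (Q M) ≤ S_k(M) for every orthogonal projection Q of rank k. Let Q be the
-- projection onto the span of the unit vectors e_u (u ∈ U) and of the indicator vector of V ∖ U; then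
-- trace (Q A_α) is exactly the right-hand side of the bound.
--
-- Ky Fan's inequality holds because trace (Q M) = ∑ λ_j w_j, where the weights w_j = ⟨v_j, Q v_j⟩ / ⟨v_j, v_j⟩
-- of an orthogonal eigenbasis lie in [0,1] and add up to k. The eigenbasis is extracted from the factorisation
-- of the characteristic polynomial by deflation: a rank-one update along an eigenvector moves one root and
-- keeps all the others.
--
-- Constructively, x ≤ y is stable under double negation for Cauchy reals, so that the case distinctions
-- "x is zero or invertible" of linear algebra may be made in the double-negation monad. Eigenvectors are never
-- normalised, so no square roots are needed.

module Submission where

open import Algebra.Bundles using (CommutativeRing; Semiring)
import Algebra.Definitions.RawSemiring as RawSemiringDefs
import Algebra.Properties.CommutativeMonoid.Sum as CommutativeMonoidSum
import Algebra.Properties.Monoid.Mult as MonoidMult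
import Algebra.Properties.Semiring.Sum as SemiringSum
import Algebra.Solver.Ring as RingSolver
open import Algebra.Solver.Ring.AlmostCommutativeRing
  using (fromCommutativeRing; _-Raw-AlmostCommutative⟶_)
open import Data.Bool.Base using (Bool; true; false; not; _∧_; _∨_; if_then_else_)
open import Data.Fin.Base as Fin using (Fin; zero; suc; toℕ; inject≤; punchIn; punchOut; fromℕ<)
import Data.Fin.Properties as Fin
open import Data.Fin.Subset using (Subset; ∣_∣; ∁)
open import Data.Fin.Subset.Properties using (_∈?_; ∣∁p∣≡n∸∣p∣)
open import Data.Integer.Base as ℤ using (+_)
import Data.Integer.Properties as ℤ
open import Data.List.Base as List using (List; []; _∷_; _++_; length; filter; allFin; cartesianProduct)
import Data.Maybe.Base as Maybe
open import Data.Nat.Base as ℕ using (ℕ; zero; suc; _∸_; z≤n; s≤s)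
import Data.Nat.ListAction as ListAction
import Data.Nat.Properties as ℕ
open import Data.Product.Base using (∃; _×_; _,_; proj₁; proj₂)
open import Data.Rational.Base as ℚ using (ℚ; 0ℚ; 1ℚ)
import Data.Rational.Properties as ℚ
open import Data.Rational.Solver using (module +-*-Solver)
import Data.Rational.Unnormalised.Base as ℚᵘ
import Data.Rational.Unnormalised.Properties as ℚᵘ
open import Data.Sum.Base using (_⊎_; inj₁; inj₂)
open import Data.Vec.Base using ([]; _∷_)
open import Data.Vec.Functional using (updateAt; tail) renaming (_∷_ to _◂_)
import Data.Vec.Functional.Properties as Vec
open import Defs using (Graph; degree; edges; numEdges; ∂; degreeSum)
open import Function.Base using (_∘_; const)
open import Level using (0ℓ)
open import Relation.Binary.Consequences using (dec⇒weaklyDec)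
open import Relation.Binary.Core using (Rel)
open import Relation.Binary.Definitions using (tri<; tri≈; tri>)
open import Relation.Binary.PropositionalEquality as ≡ using (_≡_; _≢_)
import Relation.Binary.Reasoning.Setoid as ≈-Reasoning
open import Relation.Binary.Structures using (IsPartialOrder)
open import Relation.Nullary.Decidable using (does; yes; no; dec-true; dec-false)
open import Relation.Nullary.Negation using (¬_; contradiction)
open import Relation.Unary using (Pred; Decidable)

-- The spectrum enters only through `charPoly M t ≈ product (λ i → t - ev i)`, so eigenvectors have
-- to be produced from roots of a determinant, multiplicities included. Restricting to the
-- orthogonal complement of an eigenvector would require a basis of that complement and a change of
-- coordinates; a rank-one update stays in dimension n. All treated eigenvalues are sent to one
-- number, at least 1 above every listed eigenvalue. Hence orthogonality never depends on whether
-- two listed eigenvalues coincide, a question that cannot be decided. The price is that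
-- `charPoly M t` must be divided by t - μ even at t = μ, which pointwise equations do not allow;
-- this is why polynomial functions are developed. The projection generalises the case of empty U,
-- where it is the projection onto the all-ones vector and the bound is the average degree 2m/n. In
-- general each u in U contributes its diagonal entry α d_u, and the complement contributes the
-- Rayleigh quotient of its indicator vector. The reals are reached only through the interface
-- `OrderedAlgebra`, so that no argument of linear algebra or counting looks at representing
-- sequences.

infixl 1 _>>=_

_>>=_ : {A B : Set} → ¬ ¬ A → (A → ¬ ¬ B) → ¬ ¬ B
(m >>= f) ¬b = m λ a → f a ¬b

return : {A : Set} → A → ¬ ¬ A
return a ¬a = ¬a a

-- Double negation commutes with finite conjunctions, so a finite family of undecided alternatives
-- can be settled one index after another inside the monad. `kernel` uses this to look for a pivot.
¬¬-⊎ : ∀ n {P Q : Fin n → Set} → (∀ i → ¬ ¬ (P i ⊎ Q i)) → ¬ ¬ ((∀ i → P i) ⊎ ∃ Q)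
¬¬-⊎ zero    h = return (inj₁ λ ())
¬¬-⊎ (suc n) {P} {Q} h = h zero >>= λ where
  (inj₂ q) → return (inj₂ (zero , q))
  (inj₁ p) → ¬¬-⊎ n (h ∘ suc) >>= λ where
    (inj₂ (i , q)) → return (inj₂ (suc i , q))
    (inj₁ ps)      → return (inj₁ λ { zero → p ; (suc i) → ps i })

-- A constructive substitute for an ordered field. The order is only partial, and `zero-or-unit`
-- holds only under double negation; `≤-stable` is what allows results obtained there to be brought
-- back. The `ℚ`-algebra structure supplies one half, the reciprocals of positive integers and the
-- coefficients of the ring solver.
record OrderedAlgebra : Set₁ where
  infix 4 _≤_
  field
    commutativeRing : CommutativeRing 0ℓ 0ℓ
  open CommutativeRing commutativeRing public
  field
    ℚ-algebra        : ℚ.+-*-rawRing -Raw-AlmostCommutative⟶ fromCommutativeRing commutativeRing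
    _≤_              : Rel Carrier 0ℓ
    ≤-isPartialOrder : IsPartialOrder _≈_ _≤_
    +-mono-≤         : ∀ {x y z w} → x ≤ y → z ≤ w → (x + z) ≤ (y + w)
    *-nonNeg         : ∀ {x y} → 0# ≤ x → 0# ≤ y → 0# ≤ (x * y)
    square-nonNeg    : ∀ x → 0# ≤ (x * x)
    ≤-stable         : ∀ {x y} → ¬ ¬ (x ≤ y) → x ≤ y
    1≉0              : ¬ (1# ≈ 0#)
    zero-or-unit     : ∀ x → ¬ ¬ (x ≈ 0# ⊎ ∃ λ y → x * y ≈ 1#)

module LinearAlgebra (F : OrderedAlgebra) where
  open OrderedAlgebra F public hiding (zero)
  open SemiringSum semiring using (sum; sum-cong-≋; sum-replicate-zero; ∑-distrib-+; ∑-comm; *-distribˡ-sum)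
  open RawSemiringDefs (Semiring.rawSemiring semiring) public using (product; _^_)
  module ≤ = IsPartialOrder ≤-isPartialOrder
  open _-Raw-AlmostCommutative⟶_ ℚ-algebra public

  -- The solver needs coefficients that evaluate to 0# and 1# definitionally.
  ⟦_⟧′ : ℚ → Carrier
  ⟦ q ⟧′ = if does (q ℚ.≟ 0ℚ) then 0# else if does (q ℚ.≟ 1ℚ) then 1# else ⟦ q ⟧

  ⟦⟧′≈⟦⟧ : ∀ q → ⟦ q ⟧′ ≈ ⟦ q ⟧
  ⟦⟧′≈⟦⟧ q with q ℚ.≟ 0ℚ
  ... | yes ≡.refl = sym 0-homo
  ... | no _ with q ℚ.≟ 1ℚ
  ...   | yes ≡.refl = sym 1-homo
  ...   | no _       = refl

  coefficients : ℚ.+-*-rawRing -Raw-AlmostCommutative⟶ fromCommutativeRing commutativeRing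
  coefficients = record
    { ⟦_⟧    = ⟦_⟧′
    ; +-homo = λ p q → trans (⟦⟧′≈⟦⟧ _) (trans (+-homo p q) (sym (+-cong (⟦⟧′≈⟦⟧ p) (⟦⟧′≈⟦⟧ q))))
    ; *-homo = λ p q → trans (⟦⟧′≈⟦⟧ _) (trans (*-homo p q) (sym (*-cong (⟦⟧′≈⟦⟧ p) (⟦⟧′≈⟦⟧ q))))
    ; -‿homo = λ p → trans (⟦⟧′≈⟦⟧ _) (trans (-‿homo p) (sym (-‿cong (⟦⟧′≈⟦⟧ p))))
    ; 0-homo = refl
    ; 1-homo = refl
    }

  open RingSolver ℚ.+-*-rawRing (fromCommutativeRing commutativeRing) coefficients
    (λ p q → Maybe.map (λ p≡q → reflexive (≡.cong ⟦_⟧′ p≡q)) (dec⇒weaklyDec ℚ._≟_ p q))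
    public using (solve; _:=_; _:+_; _:*_; _:-_; :-_; con)
  open ≈-Reasoning setoid public

  -- Vectors, matrices and finite sums

  Vector : ℕ → Set
  Vector n = Fin n → Carrier

  Matrix : ℕ → Set
  Matrix n = Fin n → Vector n

  infixl 6 _[_]≔_
  _[_]≔_ : {A : Set} {n : ℕ} → (Fin n → A) → Fin n → A → Fin n → A
  X [ p ]≔ r = updateAt X p (const r)

  lookup-≔ : {A : Set} {n : ℕ} (X : Fin n → A) (p : Fin n) {r : A} → (X [ p ]≔ r) p ≡ r
  lookup-≔ X p = Vec.updateAt-updates p X

  lookup-≔-≢ : {A : Set} {n : ℕ} (X : Fin n → A) {i p : Fin n} {r : A} → i ≢ p → (X [ p ]≔ r) i ≡ X i
  lookup-≔-≢ X {i} {p} i≢p = Vec.updateAt-minimal i p X i≢p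

  map-≔ : {A B : Set} {n : ℕ} (f : A → B) (X : Fin n → A) (p : Fin n) {r : A} (i : Fin n) →
          f ((X [ p ]≔ r) i) ≡ ((f ∘ X) [ p ]≔ f r) i
  map-≔ f X zero    zero    = ≡.refl
  map-≔ f X zero    (suc i) = ≡.refl
  map-≔ f X (suc p) zero    = ≡.refl
  map-≔ f X (suc p) (suc i) = map-≔ f (tail X) p i

  opaque
    ∑ : ∀ {n} → Vector n → Carrier
    ∑ = sum

    ∑≈sum : ∀ {n} (f : Vector n) → ∑ f ≈ sum f
    ∑≈sum f = refl

    ∑-empty : (f : Vector 0) → ∑ f ≈ 0#
    ∑-empty f = refl

    ∑-suc : ∀ {n} (f : Vector (suc n)) → ∑ f ≈ f zero + ∑ (f ∘ suc)
    ∑-suc f = refl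

    ∑-cong : ∀ {n} {f g : Vector n} → (∀ i → f i ≈ g i) → ∑ f ≈ ∑ g
    ∑-cong = sum-cong-≋

    ∑-zero : ∀ {n} {f : Vector n} → (∀ i → f i ≈ 0#) → ∑ f ≈ 0#
    ∑-zero {n} f≈0 = trans (∑-cong f≈0) (sum-replicate-zero n)

    ∑-+ : ∀ {n} (f g : Vector n) → ∑ (λ i → f i + g i) ≈ ∑ f + ∑ g
    ∑-+ = ∑-distrib-+

    *-∑ : ∀ {n} a (f : Vector n) → a * ∑ f ≈ ∑ λ i → a * f i
    *-∑ = *-distribˡ-sum

    ∑-swap : ∀ {m n} (f : Fin m → Fin n → Carrier) → ∑ (λ i → ∑ λ j → f i j) ≈ ∑ λ j → ∑ λ i → f i j
    ∑-swap = ∑-comm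

  ∑-single : ∀ {n} (p : Fin n) {f : Vector n} → (∀ i → i ≢ p → f i ≈ 0#) → ∑ f ≈ f p
  ∑-single zero    h = trans (∑-suc _) (trans (+-congˡ (∑-zero λ i → h (suc i) λ ())) (+-identityʳ _))
  ∑-single (suc p) h = trans (∑-suc _) (trans
    (+-cong (h zero λ ()) (∑-single p λ i i≢p → h (suc i) (i≢p ∘ Fin.suc-injective)))
    (+-identityˡ _))

  ∑-linear : ∀ {n} a b (f g : Vector n) → ∑ (λ i → a * f i + b * g i) ≈ a * ∑ f + b * ∑ g
  ∑-linear a b f g = trans (∑-+ (λ i → a * f i) (λ i → b * g i)) (+-cong (sym (*-∑ a f)) (sym (*-∑ b g)))

  -- Determinants

  sgn : ℕ → Carrier
  sgn k = (- 1#) ^ k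

  sgn-square : ∀ k → sgn k * sgn k ≈ 1#
  sgn-square zero    = *-identityˡ 1#
  sgn-square (suc k) = trans (lemma (sgn k)) (sgn-square k)
    where
    lemma : ∀ s → (- 1# * s) * (- 1# * s) ≈ s * s
    lemma = solve 1 (λ s → (:- con 1ℚ :* s) :* (:- con 1ℚ :* s) := s :* s) refl

  minor : ∀ {n} → Matrix (suc n) → Fin (suc n) → Matrix n
  minor M j r c = M (suc r) (punchIn j c)

  det : ∀ {n} → Matrix n → Carrier
  det {zero}  M = 1#
  det {suc n} M = ∑ λ j → sgn (toℕ j) * (M zero j * det (minor M j))

  det-cong : ∀ {n} {X Y : Matrix n} → (∀ i c → X i c ≈ Y i c) → det X ≈ det Y
  det-cong {zero}  h = refl
  det-cong {suc n} h = ∑-cong λ j →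
    *-congˡ (*-cong (h zero j) (det-cong λ r c → h (suc r) (punchIn j c)))

  IsLinear : ∀ {n} → (Vector n → Carrier) → Set
  IsLinear f = ∀ a b r s → f (λ c → a * r c + b * s c) ≈ a * f r + b * f s

  det-linear : ∀ {n} (X : Matrix n) p → IsLinear (λ r → det (X [ p ]≔ r))
  det-linear {suc n} X zero a b r s = trans
    (∑-cong λ j → lemma (sgn (toℕ j)) a b (r j) (s j) (det (minor X j)))
    (∑-linear a b _ _)
    where
    lemma : ∀ k a b r s d → k * ((a * r + b * s) * d) ≈ a * (k * (r * d)) + b * (k * (s * d))
    lemma = solve 6 (λ k a b r s d →
      k :* ((a :* r :+ b :* s) :* d) := a :* (k :* (r :* d)) :+ b :* (k :* (s :* d))) refl
  det-linear {suc n} X (suc p) a b r s = begin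
    det (X [ suc p ]≔ t)
      ≈⟨ ∑-cong (λ j → *-congˡ (*-congˡ (trans (expand j t)
           (trans (det-linear (minor X j) p a b (r ∘ punchIn j) (s ∘ punchIn j))
                  (+-cong (*-congˡ (sym (expand j r))) (*-congˡ (sym (expand j s)))))))) ⟩
    ∑ (λ j → sgn (toℕ j) * (X zero j * (a * det (minor (X [ suc p ]≔ r) j) + b * det (minor (X [ suc p ]≔ s) j))))
      ≈⟨ ∑-cong (λ j → lemma (sgn (toℕ j)) (X zero j) a b _ _) ⟩
    ∑ (λ j → a * (sgn (toℕ j) * (X zero j * det (minor (X [ suc p ]≔ r) j))) + b * (sgn (toℕ j) * (X zero j * det (minor (X [ suc p ]≔ s) j))))
      ≈⟨ ∑-linear a b _ _ ⟩
    a * det (X [ suc p ]≔ r) + b * det (X [ suc p ]≔ s) ∎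
    where
    t : Vector (suc n)
    t c = a * r c + b * s c
    expand : ∀ j q → det (minor (X [ suc p ]≔ q) j) ≈ det (minor X j [ p ]≔ (q ∘ punchIn j))
    expand j q = det-cong λ i c → reflexive (≡.cong (λ f → f c) (map-≔ (_∘ punchIn j) (tail X) p i))
    lemma : ∀ k x a b d e → k * (x * (a * d + b * e)) ≈ a * (k * (x * d)) + b * (k * (x * e))
    lemma = solve 6 (λ k x a b d e →
      k :* (x :* (a :* d :+ b :* e)) := a :* (k :* (x :* d)) :+ b :* (k :* (x :* e))) refl

  linear-∑ : ∀ {n m} (f : Vector n → Carrier) → IsLinear f → (∀ {r s} → (∀ c → r c ≈ s c) → f r ≈ f s) →
               (v : Vector m) (R : Fin m → Vector n) →
               f (λ c → ∑ λ i → v i * R i c) ≈ ∑ λ i → v i * f (R i)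
  linear-∑ {n} {zero}  f lin f-cong v R = begin
    -- `IsLinear` speaks of two-term combinations only, so the value at the zero vector is obtained
    -- by writing zero as such a combination with zero coefficients.
    f (λ c → ∑ λ i → v i * R i c)       ≈⟨ f-cong (λ _ → trans (∑-empty _) (sym (lemma 0# 0#))) ⟩
    f (λ _ → 0# * 0# + 0# * 0#)         ≈⟨ lin 0# 0# (λ _ → 0#) (λ _ → 0#) ⟩
    0# * f (λ _ → 0#) + 0# * f (λ _ → 0#) ≈⟨ lemma _ _ ⟩
    0#                                  ≈⟨ ∑-empty _ ⟨
    ∑ (λ i → v i * f (R i))             ∎
    where
    lemma : ∀ x y → 0# * x + 0# * y ≈ 0#
    lemma = solve 2 (λ x y → con 0ℚ :* x :+ con 0ℚ :* y := con 0ℚ) refl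
  linear-∑ {n} {suc m} f lin f-cong v R = begin
    f (λ c → ∑ λ i → v i * R i c)              ≈⟨ f-cong (λ c → trans (∑-suc _) (+-congˡ (sym (*-identityˡ _)))) ⟩
    f (λ c → v zero * R zero c + 1# * rest c)  ≈⟨ lin (v zero) 1# (R zero) rest ⟩
    v zero * f (R zero) + 1# * f rest          ≈⟨ +-congˡ (trans (*-identityˡ _) (linear-∑ f lin f-cong (v ∘ suc) (R ∘ suc))) ⟩
    v zero * f (R zero) + ∑ (λ i → v (suc i) * f (R (suc i))) ≈⟨ ∑-suc _ ⟨
    ∑ (λ i → v i * f (R i)) ∎
    where
    rest : Vector n
    rest c = ∑ λ i → v (suc i) * R (suc i) c

  det-row-cong : ∀ {n} (X : Matrix n) p {r s} → (∀ c → r c ≈ s c) → det (X [ p ]≔ r) ≈ det (X [ p ]≔ s)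
  det-row-cong X p {r} {s} r≈s = det-cong λ i c → case i c
    where
    case : ∀ i c → (X [ p ]≔ r) i c ≈ (X [ p ]≔ s) i c
    case i c with i Fin.≟ p
    ... | yes ≡.refl = begin
      (X [ p ]≔ r) p c ≡⟨ ≡.cong (λ f → f c) (lookup-≔ X p) ⟩
      r c              ≈⟨ r≈s c ⟩
      s c              ≡⟨ ≡.cong (λ f → f c) (lookup-≔ X p) ⟨
      (X [ p ]≔ s) p c ∎
    ... | no i≢p = reflexive (≡.cong (λ f → f c) (≡.trans (lookup-≔-≢ X i≢p) (≡.sym (lookup-≔-≢ X i≢p))))

  -- The Laplace expansion of a determinant along its first two rows a and b,
  -- as a function of the complementary minors D.
  laplace₂ : ∀ {n} → (a b : Vector (suc (suc n))) → ((Fin n → Fin (suc (suc n))) → Carrier) → Carrier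
  laplace₂ a b D = ∑ λ j → sgn (toℕ j) * (a j * ∑ λ k →
    sgn (toℕ k) * (b (punchIn j k) * D (punchIn j ∘ punchIn k)))

  -- When neither deleted column is column zero, the minor keeps column zero in first place:
  -- `punchIn (suc j) ∘ punchIn (suc k)` is the lift of `punchIn j ∘ punchIn k`. This is why
  -- `laplace₂` takes an arbitrary `D`: the induction replaces it by `D ∘ lift`.
  lift : ∀ {m n} → (Fin m → Fin n) → Fin (suc m) → Fin (suc n)
  lift σ zero    = zero
  lift σ (suc i) = suc (σ i)

  -- The half in `ℚ` excludes characteristic two; this turns the change of sign under a row exchange
  -- into vanishing for equal rows.
  double-zero : ∀ {x} → x + x ≈ 0# → x ≈ 0#
  double-zero {x} h = begin
    x                            ≈⟨ *-identityˡ x ⟨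
    1# * x                       ≈⟨ *-congʳ 1-homo ⟨
    ⟦ 1ℚ ⟧ * x                 ≈⟨ *-congʳ (+-homo ℚ.½ ℚ.½) ⟩
    (⟦ ℚ.½ ⟧ + ⟦ ℚ.½ ⟧) * x      ≈⟨ solve 2 (λ h x → (h :+ h) :* x := h :* (x :+ x)) refl ⟦ ℚ.½ ⟧ x ⟩
    ⟦ ℚ.½ ⟧ * (x + x)            ≈⟨ *-congˡ h ⟩
    ⟦ ℚ.½ ⟧ * 0#                 ≈⟨ zeroʳ _ ⟩
    0#                           ∎

  -- The terms involving column 0 cancel, and the others form the same expression on the remaining columns.
  laplace₂-antisym : ∀ {n} (a b : Vector (suc (suc n))) (D : (Fin n → Fin (suc (suc n))) → Carrier) →
                     (∀ {σ τ} → (∀ i → σ i ≡ τ i) → D σ ≈ D τ) →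
                     laplace₂ a b D + laplace₂ b a D ≈ 0#
  laplace₂-antisym {n} a b D D-cong = begin
    laplace₂ a b D + laplace₂ b a D
      ≈⟨ +-cong (split a b) (split b a) ⟩
    (a zero * X b + (- b zero) * X a + R a b) + (b zero * X a + (- a zero) * X b + R b a)
      ≈⟨ solve 6 (λ a b p q r s → (a :* p :+ (:- b) :* q :+ r) :+ (b :* q :+ (:- a) :* p :+ s) := r :+ s)
           refl (a zero) (b zero) (X b) (X a) (R a b) (R b a) ⟩
    R a b + R b a
      ≈⟨ remainder n a b D D-cong ⟩
    0# ∎
    where
    -- `X a` is what remains of row `a` once the other row has taken column zero. Shifting one
    -- column index past zero costs a sign, hence the coefficient `- b zero`; in `Remainder` both
    -- indices are shifted and the signs cancel.
    X : Vector (suc (suc n)) → Carrier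
    X a = ∑ λ j → sgn (toℕ j) * (a (suc j) * D (suc ∘ punchIn j))

    Remainder : ∀ n → (Vector (suc (suc n))) → (Vector (suc (suc n))) → ((Fin n → Fin (suc (suc n))) → Carrier) → Carrier
    Remainder n a b D = ∑ λ (j : Fin (suc n)) → sgn (toℕ j) * (a (suc j) * ∑ λ (k : Fin n) →
      sgn (toℕ k) * (b (suc (punchIn j k)) * D (punchIn (suc j) ∘ punchIn (suc k))))

    R : Vector (suc (suc n)) → Vector (suc (suc n)) → Carrier
    R a b = Remainder n a b D

    split : ∀ a b → laplace₂ a b D ≈ a zero * X b + (- b zero) * X a + R a b
    split a b = begin
      laplace₂ a b D
        ≈⟨ trans (∑-suc _) (+-congˡ (∑-cong λ j → *-congˡ (*-congˡ (∑-suc _)))) ⟩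
      1# * (a zero * X b) + ∑ (λ j → (- 1# * sgn (toℕ j)) * (a (suc j) *
        (1# * (b zero * D (suc ∘ punchIn j)) + ∑ (λ k → (- 1# * sgn (toℕ k)) * E j k))))
        ≈⟨ +-cong (*-identityˡ _) (∑-cong λ j → trans
             (*-congˡ (*-congˡ (+-congˡ (trans (∑-cong λ k → *-assoc _ _ _) (sym (*-∑ (- 1#) _))))))
             (lemma (sgn (toℕ j)) (a (suc j)) (b zero) (D (suc ∘ punchIn j)) (∑ λ k → sgn (toℕ k) * E j k))) ⟩
      a zero * X b + ∑ (λ j → (- b zero) * (sgn (toℕ j) * (a (suc j) * D (suc ∘ punchIn j))) +
                               1# * (sgn (toℕ j) * (a (suc j) * ∑ λ k → sgn (toℕ k) * E j k)))
        ≈⟨ +-congˡ (trans (∑-linear (- b zero) 1# _ _) (+-congˡ (*-identityˡ _))) ⟩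
      a zero * X b + ((- b zero) * X a + R a b)
        ≈⟨ +-assoc _ _ _ ⟨
      a zero * X b + (- b zero) * X a + R a b ∎
      where
      E : Fin (suc n) → Fin n → Carrier
      E j k = b (suc (punchIn j k)) * D (punchIn (suc j) ∘ punchIn (suc k))
      lemma : ∀ s a b d i → (- 1# * s) * (a * (1# * (b * d) + (- 1#) * i)) ≈ (- b) * (s * (a * d)) + 1# * (s * (a * i))
      lemma = solve 5 (λ s a b d i → (:- con 1ℚ :* s) :* (a :* (con 1ℚ :* (b :* d) :+ (:- con 1ℚ) :* i))
        := (:- b) :* (s :* (a :* d)) :+ con 1ℚ :* (s :* (a :* i))) refl

    remainder : ∀ n (a b : Vector (suc (suc n))) D → (∀ {σ τ} → (∀ i → σ i ≡ τ i) → D σ ≈ D τ) →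
                Remainder n a b D + Remainder n b a D ≈ 0#
    remainder zero a b D _ = trans (+-cong (vanish a b) (vanish b a)) (+-identityˡ 0#)
      where
      vanish : ∀ a b → Remainder zero a b D ≈ 0#
      vanish a b = ∑-zero λ j → trans (*-congˡ (trans (*-congˡ (∑-empty _)) (zeroʳ _))) (zeroʳ _)
    remainder (suc m) a b D D-cong = trans
      (+-cong (shift a b) (shift b a))
      (laplace₂-antisym (a ∘ suc) (b ∘ suc) (D ∘ lift) λ σ≡τ → D-cong λ { zero → ≡.refl ; (suc i) → ≡.cong suc (σ≡τ i) })
      where
      shift : ∀ a b → Remainder (suc m) a b D ≈ laplace₂ (a ∘ suc) (b ∘ suc) (D ∘ lift)
      shift a b = ∑-cong λ j → *-congˡ (*-congˡ (∑-cong λ k → *-congˡ (*-congˡ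
        (D-cong λ { zero → ≡.refl ; (suc i) → ≡.refl }))))

  swap₀₁ : ∀ {A : Set} {n} → (Fin (suc (suc n)) → A) → Fin (suc (suc n)) → A
  swap₀₁ X zero          = X (suc zero)
  swap₀₁ X (suc zero)    = X zero
  swap₀₁ X (suc (suc i)) = X (suc (suc i))

  det-swap₀₁ : ∀ {n} (X : Matrix (suc (suc n))) → det X + det (swap₀₁ X) ≈ 0#
  det-swap₀₁ X = laplace₂-antisym (X zero) (X (suc zero)) (λ σ → det λ r c → X (suc (suc r)) (σ c))
    λ σ≡τ → det-cong λ r c → reflexive (≡.cong (X (suc (suc r))) (σ≡τ c))

  -- Only the exchange of the first two rows is available. Equal rows below the first one stay equal
  -- in every minor, which gives an induction; rows zero and one are settled by the exchange itself;
  -- and if row zero equals a later row, the exchange moves the equal pair below the first row.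
  det-alternating : ∀ {n} (X : Matrix n) i j → i ≢ j → (∀ c → X i c ≈ X j c) → det X ≈ 0#
  det-alternating {suc n} X i j = go i j X
    where
    below : ∀ i j (X : Matrix (suc n)) → suc i ≢ suc j → (∀ c → X (suc i) c ≈ X (suc j) c) → det X ≈ 0#
    below i j X i≢j Xi≈Xj = ∑-zero λ k → trans
      (*-congˡ (trans (*-congˡ (det-alternating (minor X k) i j (i≢j ∘ ≡.cong suc) (Xi≈Xj ∘ punchIn k))) (zeroʳ _)))
      (zeroʳ _)

    first : ∀ {m} → (∀ i j (X : Matrix (suc m)) → suc i ≢ suc j → (∀ c → X (suc i) c ≈ X (suc j) c) → det X ≈ 0#) →
            ∀ j (X : Matrix (suc m)) → (∀ c → X zero c ≈ X (suc j) c) → det X ≈ 0#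
    first below zero X X₀≈X₁ = double-zero (trans (+-congˡ (det-cong eq)) (det-swap₀₁ X))
      where
      eq : ∀ i c → X i c ≈ swap₀₁ X i c
      eq zero          c = X₀≈X₁ c
      eq (suc zero)    c = sym (X₀≈X₁ c)
      eq (suc (suc i)) c = refl
    first below (suc j) X X₀≈Xⱼ = begin
      det X                    ≈⟨ +-identityʳ _ ⟨
      det X + 0#               ≈⟨ +-congˡ (below zero (suc j) (swap₀₁ X) (λ ()) X₀≈Xⱼ) ⟨
      det X + det (swap₀₁ X)   ≈⟨ det-swap₀₁ X ⟩
      0#                       ∎

    go : ∀ i j (X : Matrix (suc n)) → i ≢ j → (∀ c → X i c ≈ X j c) → det X ≈ 0#
    go zero    zero    X i≢j _     = contradiction ≡.refl i≢j
    go zero    (suc j) X _   Xi≈Xj = first below j X Xi≈Xj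
    go (suc i) zero    X _   Xi≈Xj = first below i X (sym ∘ Xi≈Xj)
    go (suc i) (suc j) X i≢j Xi≈Xj = below i j X i≢j Xi≈Xj

  ≔-trivial : ∀ {n} (X : Matrix n) p i c → (X [ p ]≔ X p) i c ≈ X i c
  ≔-trivial X p i c = reflexive (≡.cong (λ f → f c) (Vec.updateAt-id-local p X ≡.refl i))

  det-repeated-row : ∀ {n} (X : Matrix n) {i p} → i ≢ p → ∀ {r} → (∀ c → r c ≈ X i c) → det (X [ p ]≔ r) ≈ 0#
  det-repeated-row X {i} {p} i≢p r≈Xi = det-alternating _ i p i≢p λ c →
    trans (reflexive (≡.cong (λ f → f c) (lookup-≔-≢ X i≢p)))
          (trans (sym (r≈Xi c)) (reflexive (≡.cong (λ f → f c) (≡.sym (lookup-≔ X p)))))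

  -- Cramer's rule without adjugates: every summand other than the one with index `p` repeats a row.
  det-row-combination : ∀ {n} (X : Matrix n) (v : Vector n) p →
                        det (X [ p ]≔ λ c → ∑ λ i → v i * X i c) ≈ v p * det X
  det-row-combination X v p = begin
    det (X [ p ]≔ λ c → ∑ λ i → v i * X i c)
      ≈⟨ linear-∑ (λ r → det (X [ p ]≔ r)) (det-linear X p) (det-row-cong X p) v X ⟩
    ∑ (λ i → v i * det (X [ p ]≔ X i))
      ≈⟨ ∑-single p (λ i i≢p → trans (*-congˡ (det-repeated-row X i≢p λ _ → refl)) (zeroʳ _)) ⟩
    v p * det (X [ p ]≔ X p)
      ≈⟨ *-congˡ (det-cong (≔-trivial X p)) ⟩
    v p * det X ∎

  det-row-scale : ∀ {n} (X : Matrix n) p a r → det (X [ p ]≔ λ c → a * r c) ≈ a * det (X [ p ]≔ r)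
  det-row-scale X p a r = begin
    det (X [ p ]≔ λ c → a * r c)           ≈⟨ det-row-cong X p (λ c → solve 2 (λ a r → a :* r := a :* r :+ con 0ℚ :* r) refl a (r c)) ⟩
    det (X [ p ]≔ λ c → a * r c + 0# * r c) ≈⟨ det-linear X p a 0# r r ⟩
    a * det (X [ p ]≔ r) + 0# * det (X [ p ]≔ r) ≈⟨ solve 2 (λ a r → a :* r :+ con 0ℚ :* r := a :* r) refl a _ ⟩
    a * det (X [ p ]≔ r) ∎

  -- A hybrid argument: `X` is turned into `Y` one entry at a time. Each step may use that every
  -- entry of the current hybrid `Z` is either old or new, which is how `det-add-multiples` keeps
  -- hold of its pivot row.
  replace-all : ∀ {n} {A : Set} (F : (Fin n → A) → Carrier) → (∀ {Z W} → (∀ i → Z i ≡ W i) → F Z ≈ F W) →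
                (X Y : Fin n → A) →
                (∀ Z i → (∀ j → Z j ≡ X j ⊎ Z j ≡ Y j) → Z i ≡ X i → F Z ≈ F (Z [ i ]≔ Y i)) →
                F X ≈ F Y
  replace-all {zero}  F F-cong X Y step = F-cong λ ()
  replace-all {suc n} F F-cong X Y step = begin
    F X                  ≈⟨ F-cong (λ { zero → ≡.refl ; (suc i) → ≡.refl }) ⟩
    F (X zero ◂ tail X)  ≈⟨ replace-all (λ Z → F (X zero ◂ Z)) (λ Z≡W → F-cong λ { zero → ≡.refl ; (suc i) → Z≡W i })
                              (tail X) (tail Y) (λ Z i h Zi → trans
                                (step (X zero ◂ Z) (suc i) (λ { zero → inj₁ ≡.refl ; (suc j) → h j }) Zi)
                                (F-cong λ { zero → ≡.refl ; (suc j) → ≡.refl })) ⟩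
    F (X zero ◂ tail Y)  ≈⟨ step (X zero ◂ tail Y) zero (λ { zero → inj₁ ≡.refl ; (suc j) → inj₂ ≡.refl }) ≡.refl ⟩
    F ((X zero ◂ tail Y) [ zero ]≔ Y zero) ≈⟨ F-cong (λ { zero → ≡.refl ; (suc i) → ≡.refl }) ⟩
    F Y                  ∎

  det-add-multiples : ∀ {n} (X Y : Matrix n) (s : Vector n) p → (∀ c → Y p c ≈ X p c) →
                      (∀ i → i ≢ p → ∀ c → Y i c ≈ X i c + s i * X p c) → det Y ≈ det X
  det-add-multiples X Y s p Yp≈Xp Yi≈ = sym (replace-all det
    (λ Z≡W → det-cong λ i c → reflexive (≡.cong (λ f → f c) (Z≡W i))) X Y step)
    where
    step : ∀ Z i → (∀ j → Z j ≡ X j ⊎ Z j ≡ Y j) → Z i ≡ X i → det Z ≈ det (Z [ i ]≔ Y i)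
    step Z i h Zi≡Xi with i Fin.≟ p
    ... | yes ≡.refl = begin
      det Z                ≈⟨ det-cong (≔-trivial Z p) ⟨
      det (Z [ p ]≔ Z p)   ≈⟨ det-row-cong Z p (λ c → trans (reflexive (≡.cong (λ f → f c) Zi≡Xi)) (sym (Yp≈Xp c))) ⟩
      det (Z [ p ]≔ Y p)   ∎
    ... | no i≢p = sym (begin
      det (Z [ i ]≔ Y i)
        ≈⟨ det-row-cong Z i (λ c → trans (Yi≈ i i≢p c) (+-cong (trans (reflexive (≡.cong (λ f → f c) (≡.sym Zi≡Xi))) (sym (*-identityˡ _))) refl)) ⟩
      det (Z [ i ]≔ λ c → 1# * Z i c + s i * X p c)
        ≈⟨ det-linear Z i 1# (s i) (Z i) (X p) ⟩
      1# * det (Z [ i ]≔ Z i) + s i * det (Z [ i ]≔ X p)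
        ≈⟨ +-cong (*-congˡ (det-cong (≔-trivial Z i))) (*-congˡ (det-repeated-row Z (i≢p ∘ ≡.sym) Xp≈Zp)) ⟩
      1# * det Z + s i * 0#
        ≈⟨ solve 2 (λ d s → con 1ℚ :* d :+ s :* con 0ℚ := d) refl (det Z) (s i) ⟩
      det Z ∎)
      where
      -- The pivot row is the same in `X` and `Y`, so it does not matter whether the hybrid has
      -- already replaced it.
      Xp≈Zp : ∀ c → X p c ≈ Z p c
      Xp≈Zp c with h p
      ... | inj₁ Zp≡Xp = reflexive (≡.cong (λ f → f c) (≡.sym Zp≡Xp))
      ... | inj₂ Zp≡Yp = trans (sym (Yp≈Xp c)) (reflexive (≡.cong (λ f → f c) (≡.sym Zp≡Yp)))

  det-zero-column : ∀ {n} (X : Matrix n) q → (∀ i → X i q ≈ 0#) → det X ≈ 0#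
  det-zero-column {suc n} X q Xq≈0 = ∑-zero λ j → trans (*-congˡ (term j)) (zeroʳ _)
    where
    term : ∀ j → X zero j * det (minor X j) ≈ 0#
    term j with j Fin.≟ q
    ... | yes ≡.refl = trans (*-congʳ (Xq≈0 zero)) (zeroˡ _)
    ... | no j≢q = trans (*-congˡ (det-zero-column (minor X j) (punchOut j≢q) λ i →
            trans (reflexive (≡.cong (X (suc i)) (Fin.punchIn-punchOut j≢q))) (Xq≈0 (suc i))))
          (zeroʳ _)

  -- Units, order and left kernels of singular matrices

  ≈-stable : ∀ {x y} → ¬ ¬ (x ≈ y) → x ≈ y
  ≈-stable x≈y = ≤.antisym (≤-stable (x≈y >>= λ e → return (≤.reflexive e)))
                           (≤-stable (x≈y >>= λ e → return (≤.reflexive (sym e))))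

  Unit : Carrier → Set
  Unit x = ∃ λ y → x * y ≈ 1#

  cancel-unit : ∀ {x z} → Unit x → x * z ≈ 0# → z ≈ 0#
  cancel-unit {x} {z} (y , xy≈1) xz≈0 = begin
    z             ≈⟨ *-identityˡ z ⟨
    1# * z        ≈⟨ *-congʳ xy≈1 ⟨
    (x * y) * z   ≈⟨ solve 3 (λ x y z → (x :* y) :* z := y :* (x :* z)) refl x y z ⟩
    y * (x * z)   ≈⟨ *-congˡ xz≈0 ⟩
    y * 0#        ≈⟨ zeroʳ y ⟩
    0#            ∎

  unit-nonzero : ∀ {x} → Unit x → ¬ (x ≈ 0#)
  unit-nonzero (y , xy≈1) x≈0 = 1≉0 (trans (sym xy≈1) (trans (*-congʳ x≈0) (zeroˡ y)))

  0≤1 : 0# ≤ 1#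
  0≤1 = ≤.trans (square-nonNeg 1#) (≤.reflexive (*-identityˡ 1#))

  -- Cancellation without an inverse at hand: a number bounded below by 1 is not zero, hence a unit
  -- under double negation, and the equation to be proved is stable. The bound 1 expresses apartness
  -- from zero in terms of `≤` alone.
  cancel-≥1 : ∀ {x z} → 1# ≤ x → x * z ≈ 0# → z ≈ 0#
  cancel-≥1 {x} 1≤x xz≈0 = ≈-stable (zero-or-unit x >>= λ where
    (inj₁ x≈0) → contradiction (≤.antisym (≤.trans 1≤x (≤.reflexive x≈0)) 0≤1) 1≉0
    (inj₂ u)   → return (cancel-unit u xz≈0))

  square-zero : ∀ {x} → x * x ≈ 0# → x ≈ 0#
  square-zero {x} xx≈0 = ≈-stable (zero-or-unit x >>= λ where
    (inj₁ x≈0) → return x≈0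
    (inj₂ u)   → return (cancel-unit u xx≈0))

  -‿nonNeg : ∀ {x y} → x ≤ y → 0# ≤ (y - x)
  -‿nonNeg {x} {y} x≤y = ≤.trans (≤.reflexive (sym (-‿inverseʳ x))) (+-mono-≤ x≤y ≤.refl)

  -‿nonNeg⁻¹ : ∀ {x y} → 0# ≤ (y - x) → x ≤ y
  -‿nonNeg⁻¹ {x} {y} 0≤y-x = ≤.trans (≤.reflexive (sym (+-identityˡ x)))
    (≤.trans (+-mono-≤ 0≤y-x ≤.refl) (≤.reflexive (solve 2 (λ x y → (y :- x) :+ x := y) refl x y)))

  *-monoˡ-≤ : ∀ {a x y} → 0# ≤ a → x ≤ y → (a * x) ≤ (a * y)
  *-monoˡ-≤ {a} {x} {y} 0≤a x≤y = -‿nonNeg⁻¹ (≤.trans (*-nonNeg 0≤a (-‿nonNeg x≤y))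
    (≤.reflexive (solve 3 (λ a x y → a :* (y :- x) := a :* y :- a :* x) refl a x y)))

  ∑-nonNeg : ∀ {n} {f : Vector n} → (∀ i → 0# ≤ f i) → 0# ≤ ∑ f
  ∑-nonNeg {zero}  h = ≤.reflexive (sym (∑-empty _))
  ∑-nonNeg {suc n} h = ≤.trans (≤.reflexive (sym (+-identityˡ 0#)))
    (≤.trans (+-mono-≤ (h zero) (∑-nonNeg (h ∘ suc))) (≤.reflexive (sym (∑-suc _))))

  term≤∑ : ∀ {n} {f : Vector n} → (∀ i → 0# ≤ f i) → ∀ p → f p ≤ ∑ f
  term≤∑ h zero    = ≤.trans (≤.reflexive (sym (+-identityʳ _)))
    (≤.trans (+-mono-≤ ≤.refl (∑-nonNeg (h ∘ suc))) (≤.reflexive (sym (∑-suc _))))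
  term≤∑ h (suc p) = ≤.trans (≤.reflexive (sym (+-identityˡ _)))
    (≤.trans (+-mono-≤ (h zero) (term≤∑ (h ∘ suc) p)) (≤.reflexive (sym (∑-suc _))))

  ∑-nonNeg-zero : ∀ {n} {f : Vector n} → (∀ i → 0# ≤ f i) → ∑ f ≈ 0# → ∀ p → f p ≈ 0#
  ∑-nonNeg-zero h ∑≈0 p = ≤.antisym (≤.trans (term≤∑ h p) (≤.reflexive ∑≈0)) (h p)

  -- That the vector is nonzero is recorded positively, as an invertible coordinate: `deflate`
  -- replaces exactly that row of the matrix and then divides by the coordinate.
  LeftKernel : ∀ {n} → Matrix n → Set
  LeftKernel {n} X = ∃ λ (v : Vector n) → (∃ λ (p : Fin n) → Unit (v p)) × ∀ c → ∑ (λ i → v i * X i c) ≈ 0#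

  -- Gaussian elimination along the first row. If that row vanishes, the first unit vector is in the
  -- kernel. Otherwise a pivot clears its column below row zero, and by expansion the complementary
  -- minor is singular, of size one less.
  kernel : ∀ {n} (X : Matrix n) → det X ≈ 0# →
           ¬ ¬ LeftKernel X
  kernel {zero}  X 1≈0   = contradiction 1≈0 1≉0
  kernel {suc n} X det≈0 = ¬¬-⊎ (suc n) (λ p → zero-or-unit (X zero p)) >>= λ where
      (inj₁ X₀≈0)        → return (1# ◂ (λ _ → 0#) , (zero , 1# , *-identityˡ 1#) , λ c →
        trans (∑-single zero λ { zero ne → contradiction ≡.refl ne ; (suc i) _ → zeroˡ _ }) (trans (*-identityˡ _) (X₀≈0 c)))
      (inj₂ (p , y , xy≈1)) → eliminate p y xy≈1
    where
    eliminate : ∀ p y → X zero p * y ≈ 1# →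
                ¬ ¬ LeftKernel X
    eliminate p y xy≈1 = kernel (minor Y p) minor≈0 >>= λ (w , (q , wq-unit) , w-kills) →
        -- The row operations are undone: the new coordinate collects the multiples of row zero that
        -- elimination added to the other rows.
        return (∑ (λ i → w i * s (suc i)) ◂ w , (suc q , wq-unit) , λ c → begin
          ∑ (λ i → (∑ (λ i → w i * s (suc i)) ◂ w) i * X i c)
            ≈⟨ ∑-suc _ ⟩
          ∑ (λ i → w i * s (suc i)) * X zero c + ∑ (λ i → w i * X (suc i) c)
            ≈⟨ solve 3 (λ a x b → a :* x :+ b := x :* a :+ con 1ℚ :* b) refl _ _ _ ⟩
          X zero c * ∑ (λ i → w i * s (suc i)) + 1# * ∑ (λ i → w i * X (suc i) c)
            ≈⟨ ∑-linear (X zero c) 1# _ _ ⟨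
          ∑ (λ i → X zero c * (w i * s (suc i)) + 1# * (w i * X (suc i) c))
            ≈⟨ ∑-cong (λ i → solve 4 (λ x w s b → x :* (w :* s) :+ con 1ℚ :* (w :* b) := w :* (b :+ s :* x))
                 refl (X zero c) (w i) (s (suc i)) (X (suc i) c)) ⟩
          ∑ (λ i → w i * Y (suc i) c)
            ≈⟨ kills w w-kills c ⟩
          0# ∎)
      where
      s : Vector (suc n)
      s i = - (X i p * y)

      Y : Matrix (suc n)
      Y zero    c = X zero c
      Y (suc i) c = X (suc i) c + s (suc i) * X zero c

      column : ∀ i → Y (suc i) p ≈ 0#
      column i = begin
        X (suc i) p + - (X (suc i) p * y) * X zero p
          ≈⟨ solve 3 (λ a y x → a :+ (:- (a :* y)) :* x := a :- a :* (x :* y)) refl (X (suc i) p) y (X zero p) ⟩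
        X (suc i) p - X (suc i) p * (X zero p * y)
          ≈⟨ +-congˡ (-‿cong (*-congˡ xy≈1)) ⟩
        X (suc i) p - X (suc i) p * 1#
          ≈⟨ solve 1 (λ a → a :- a :* con 1ℚ := con 0ℚ) refl (X (suc i) p) ⟩
        0# ∎

      expansion : sgn (toℕ p) * (X zero p * det (minor Y p)) ≈ 0#
      expansion = begin
        sgn (toℕ p) * (X zero p * det (minor Y p))
          ≈⟨ ∑-single p (λ j j≢p → trans (*-congˡ (trans (*-congˡ (det-zero-column (minor Y j) (punchOut j≢p) λ i →
               trans (reflexive (≡.cong (Y (suc i)) (Fin.punchIn-punchOut j≢p))) (column i))) (zeroʳ _))) (zeroʳ _)) ⟨
        det Y
          ≈⟨ det-add-multiples X Y s zero (λ _ → refl) (λ { zero ne _ → contradiction ≡.refl ne ; (suc i) _ _ → refl }) ⟩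
        det X
          ≈⟨ det≈0 ⟩
        0# ∎

      minor≈0 : det (minor Y p) ≈ 0#
      minor≈0 = cancel-unit (y , xy≈1) (cancel-unit (sgn (toℕ p) , sgn-square (toℕ p)) expansion)

      kills : ∀ w → (∀ c → ∑ (λ i → w i * minor Y p i c) ≈ 0#) → ∀ c → ∑ (λ i → w i * Y (suc i) c) ≈ 0#
      kills w h c with p Fin.≟ c
      ... | yes ≡.refl = ∑-zero λ i → trans (*-congˡ (column i)) (zeroʳ _)
      ... | no p≢c = trans (∑-cong λ i → *-congˡ (reflexive (≡.cong (Y (suc i)) (≡.sym (Fin.punchIn-punchOut p≢c)))))
                           (h (punchOut p≢c))

  -- Polynomial functions

  -- Degree < d, characterised by divided differences.
  Poly : ℕ → (Carrier → Carrier) → Set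
  Poly zero    f = ∀ t → f t ≈ 0#
  Poly (suc d) f = ∀ r → ∃ λ q → Poly d q × ∀ t → f t ≈ f r + (t - r) * q t

  IsPoly : (Carrier → Carrier) → Set
  IsPoly f = ∃ λ d → Poly d f

  poly-cong : ∀ d {f g} → (∀ t → f t ≈ g t) → Poly d f → Poly d g
  poly-cong zero    f≈g f≈0 t = trans (sym (f≈g t)) (f≈0 t)
  poly-cong (suc d) f≈g pf r =
    let q , pq , f≈ = pf r in q , pq , λ t → trans (sym (f≈g t)) (trans (f≈ t) (+-congʳ (f≈g r)))

  poly-0 : ∀ d {f} → (∀ t → f t ≈ 0#) → Poly d f
  poly-0 zero    f≈0   = f≈0
  poly-0 (suc d) f≈0 r = (λ _ → 0#) , poly-0 d (λ _ → refl) , λ t →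
    trans (f≈0 t) (trans (solve 1 (λ a → con 0ℚ := con 0ℚ :+ a :* con 0ℚ) refl (t - r)) (+-congʳ (sym (f≈0 r))))

  poly-const : ∀ a → Poly 1 (λ _ → a)
  poly-const a r = (λ _ → 0#) , (λ _ → refl) , λ t →
    solve 2 (λ a b → a := a :+ b :* con 0ℚ) refl a (t - r)

  poly-id : Poly 2 (λ t → t)
  poly-id r = (λ _ → 1#) , poly-const 1# , solve 2 (λ r t → t := r :+ (t :- r) :* con 1ℚ) refl r

  poly-weaken : ∀ d e {f} → Poly d f → Poly (d ℕ.+ e) f
  poly-weaken zero    e pf   = poly-0 e pf
  poly-weaken (suc d) e pf r = let q , pq , f≈ = pf r in q , poly-weaken d e pq , f≈

  poly-+ : ∀ d {f g} → Poly d f → Poly d g → Poly d (λ t → f t + g t)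
  poly-+ zero    pf pg t = trans (+-cong (pf t) (pg t)) (+-identityˡ 0#)
  poly-+ (suc d) {f} {g} pf pg r =
    let q , pq , f≈ = pf r
        s , ps , g≈ = pg r
    in (λ t → q t + s t) , poly-+ d pq ps , λ t → trans (+-cong (f≈ t) (g≈ t))
         (solve 5 (λ a b x q s → (a :+ x :* q) :+ (b :+ x :* s) := (a :+ b) :+ x :* (q :+ s)) refl (f r) (g r) (t - r) (q t) (s t))

  poly-scale : ∀ d a {f} → Poly d f → Poly d (λ t → a * f t)
  poly-scale zero    a pf t = trans (*-congˡ (pf t)) (zeroʳ a)
  poly-scale (suc d) a {f} pf r =
    let q , pq , f≈ = pf r
    in (λ t → a * q t) , poly-scale d a pq , λ t → trans (*-congˡ (f≈ t))
         (solve 4 (λ a b x q → a :* (b :+ x :* q) := a :* b :+ x :* (a :* q)) refl a (f r) (t - r) (q t))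

  -- Divided differences obey a product rule: the quotient of `f * g` at `r` is `q * g + f r * s`,
  -- and both of its summands have a total bound smaller by one.
  poly-* : ∀ d e {f g} → Poly d f → Poly e g → Poly (d ℕ.+ e) (λ t → f t * g t)
  poly-* zero    e       pf pg = poly-0 e λ t → trans (*-congʳ (pf t)) (zeroˡ _)
  poly-* (suc d) zero    pf pg = poly-0 (suc d ℕ.+ zero) λ t → trans (*-congˡ (pg t)) (zeroʳ _)
  poly-* (suc d) (suc e) {f} {g} pf pg r =
    let q , pq , f≈ = pf r
        s , ps , g≈ = pg r
    in (λ t → q t * g t + f r * s t)
     , poly-+ (d ℕ.+ suc e) (poly-* d (suc e) pq pg)
         (≡.subst (λ k → Poly k (λ t → f r * s t)) (≡.trans (ℕ.+-comm e (suc d)) (≡.sym (ℕ.+-suc d e)))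
           (poly-weaken e (suc d) (poly-scale e (f r) ps)))
     , λ t → begin
         f t * g t                            ≈⟨ *-cong (f≈ t) refl ⟩
         (f r + (t - r) * q t) * g t          ≈⟨ solve 4 (λ a x q g → (a :+ x :* q) :* g := a :* g :+ x :* (q :* g)) refl (f r) (t - r) (q t) (g t) ⟩
         f r * g t + (t - r) * (q t * g t)    ≈⟨ +-congʳ (*-congˡ (g≈ t)) ⟩
         f r * (g r + (t - r) * s t) + (t - r) * (q t * g t)
           ≈⟨ solve 5 (λ a b x s u → a :* (b :+ x :* s) :+ x :* u := a :* b :+ x :* (u :+ a :* s)) refl (f r) (g r) (t - r) (s t) (q t * g t) ⟩
         f r * g r + (t - r) * (q t * g t + f r * s t) ∎

  isPoly-+ : ∀ {f g} → IsPoly f → IsPoly g → IsPoly (λ t → f t + g t)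
  isPoly-+ {g = g} (d , pf) (e , pg) = d ℕ.+ e , poly-+ (d ℕ.+ e) (poly-weaken d e pf)
    (≡.subst (λ k → Poly k g) (ℕ.+-comm e d) (poly-weaken e d pg))

  isPoly-* : ∀ {f g} → IsPoly f → IsPoly g → IsPoly (λ t → f t * g t)
  isPoly-* (d , pf) (e , pg) = d ℕ.+ e , poly-* d e pf pg

  isPoly-const : ∀ a → IsPoly (λ _ → a)
  isPoly-const a = 1 , poly-const a

  isPoly-cong : ∀ {f g} → (∀ t → f t ≈ g t) → IsPoly f → IsPoly g
  isPoly-cong f≈g (d , pf) = d , poly-cong d f≈g pf

  isPoly-linear : ∀ a b → IsPoly (λ t → t * a - b)
  isPoly-linear a b = isPoly-+ (isPoly-* (2 , poly-id) (isPoly-const a)) (isPoly-const (- b))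

  isPoly-∑ : ∀ {n} (f : Fin n → Carrier → Carrier) → (∀ i → IsPoly (f i)) → IsPoly (λ t → ∑ λ i → f i t)
  isPoly-∑ {zero}  f pf = isPoly-cong (λ _ → sym (∑-empty _)) (isPoly-const 0#)
  isPoly-∑ {suc n} f pf = isPoly-cong (λ _ → sym (∑-suc _)) (isPoly-+ (pf zero) (isPoly-∑ (f ∘ suc) (pf ∘ suc)))

  isPoly-∏ : ∀ {n} (a : Vector n) → IsPoly (λ t → product λ i → t - a i)
  isPoly-∏ {zero}  a = isPoly-const 1#
  isPoly-∏ {suc n} a = isPoly-* (isPoly-+ (2 , poly-id) (isPoly-const (- a zero))) (isPoly-∏ (a ∘ suc))

  isPoly-det : ∀ {n} (X : Carrier → Matrix n) → (∀ i c → IsPoly (λ t → X t i c)) → IsPoly (λ t → det (X t))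
  isPoly-det {zero}  X pX = isPoly-const 1#
  isPoly-det {suc n} X pX = isPoly-∑ _ λ j → isPoly-* (isPoly-const (sgn (toℕ j)))
    (isPoly-* (pX zero j) (isPoly-det (λ t → minor (X t) j) λ i c → pX (suc i) (punchIn j c)))

  -- An infinite sequence of zeros never has to be counted against the degree: passing to the
  -- divided difference at `x 0` uses up one zero and leaves the tail. The gaps make the factors
  -- `x (suc j) - x 0` cancellable.
  poly-vanish : ∀ d {f} → Poly d f → (x : ℕ → Carrier) → (∀ j k → 1# ≤ (x (suc (j ℕ.+ k)) - x j)) →
                (∀ j → f (x j) ≈ 0#) → ∀ t → f t ≈ 0#
  poly-vanish zero    pf x _   _   = pf
  poly-vanish (suc d) {f} pf x gap fx≈0 t =
    let q , pq , f≈ = pf (x 0)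
        q≈0 = poly-vanish d pq (x ∘ suc) (λ j k → gap (suc j) k) λ j → cancel-≥1 (gap 0 j) (begin
          (x (suc j) - x 0) * q (x (suc j))          ≈⟨ +-identityˡ _ ⟨
          0# + (x (suc j) - x 0) * q (x (suc j))     ≈⟨ +-congʳ (fx≈0 0) ⟨
          f (x 0) + (x (suc j) - x 0) * q (x (suc j)) ≈⟨ f≈ (x (suc j)) ⟨
          f (x (suc j))                              ≈⟨ fx≈0 (suc j) ⟩
          0#                                         ∎)
    in begin
      f t                          ≈⟨ f≈ t ⟩
      f (x 0) + (t - x 0) * q t    ≈⟨ +-cong (fx≈0 0) (*-congˡ (q≈0 t)) ⟩
      0# + (t - x 0) * 0#          ≈⟨ solve 1 (λ a → con 0ℚ :+ a :* con 0ℚ := con 0ℚ) refl (t - x 0) ⟩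
      0#                           ∎

  -- At t = a the hypothesis is void. It is used at a + 1, a + 2, ..., where the factor is at least
  -- 1; being polynomial then forces `f` to vanish everywhere, including at `a`.
  poly-cancel : ∀ {f} a → IsPoly f → (∀ t → (t - a) * f t ≈ 0#) → ∀ t → f t ≈ 0#
  poly-cancel {f} a (d , pf) h = poly-vanish d pf x gap λ j → cancel-≥1 (x-a≥1 j) (h (x j))
    where
    open MonoidMult +-monoid using (×-homo-+) renaming (_×_ to _×ℕ_)
    x : ℕ → Carrier
    x j = a + suc j ×ℕ 1#
    ×ℕ-nonNeg : ∀ k → 0# ≤ (k ×ℕ 1#)
    ×ℕ-nonNeg zero    = ≤.refl
    ×ℕ-nonNeg (suc k) = ≤.trans (≤.reflexive (sym (+-identityˡ 0#))) (+-mono-≤ 0≤1 (×ℕ-nonNeg k))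
    suc-×ℕ≥1 : ∀ k → 1# ≤ (suc k ×ℕ 1#)
    suc-×ℕ≥1 k = ≤.trans (≤.reflexive (sym (+-identityʳ 1#))) (+-mono-≤ ≤.refl (×ℕ-nonNeg k))
    x-a≥1 : ∀ j → 1# ≤ (x j - a)
    x-a≥1 j = ≤.trans (suc-×ℕ≥1 j) (≤.reflexive (solve 2 (λ a b → b := (a :+ b) :- a) refl a _))
    gap : ∀ j k → 1# ≤ (x (suc (j ℕ.+ k)) - x j)
    gap j k = ≤.trans (suc-×ℕ≥1 k) (≤.reflexive (begin
      suc k ×ℕ 1#
        ≈⟨ solve 3 (λ a b c → b := (a :+ (c :+ b)) :- (a :+ c)) refl a _ (suc j ×ℕ 1#) ⟩
      (a + (suc j ×ℕ 1# + suc k ×ℕ 1#)) - x j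
        ≈⟨ +-congʳ (+-congˡ (×-homo-+ 1# (suc j) (suc k))) ⟨
      (a + (suc j ℕ.+ suc k) ×ℕ 1#) - x j
        ≡⟨ ≡.cong (λ m → (a + m ×ℕ 1#) - x j) (≡.cong suc (ℕ.+-suc j k)) ⟩
      x (suc (j ℕ.+ k)) - x j ∎))

  -- Characteristic polynomials and eigenvectors

  δ : ∀ {n} → Matrix n
  δ i j = if does (i Fin.≟ j) then 1# else 0#

  δ-diagonal : ∀ {n} (i : Fin n) → δ i i ≈ 1#
  δ-diagonal i with i Fin.≟ i
  ... | yes _  = refl
  ... | no i≢i = contradiction ≡.refl i≢i

  δ-off-diagonal : ∀ {n} {i j : Fin n} → i ≢ j → δ i j ≈ 0#
  δ-off-diagonal {i = i} {j} i≢j with i Fin.≟ j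
  ... | yes i≡j = contradiction i≡j i≢j
  ... | no _    = refl

  ∑-*δ : ∀ {n} (f : Vector n) c → ∑ (λ i → f i * δ i c) ≈ f c
  ∑-*δ f c = trans (∑-single c λ i i≢c → trans (*-congˡ (δ-off-diagonal i≢c)) (zeroʳ _))
                   (trans (*-congˡ (δ-diagonal c)) (*-identityʳ _))

  ∑-δ* : ∀ {n} i (f : Vector n) → ∑ (λ c → δ i c * f c) ≈ f i
  ∑-δ* i f = trans (∑-single i λ c c≢i → trans (*-congʳ (δ-off-diagonal (c≢i ∘ ≡.sym))) (zeroˡ _))
                   (trans (*-congʳ (δ-diagonal i)) (*-identityˡ _))

  charPoly : ∀ {n} → Matrix n → Carrier → Carrier
  charPoly M t = det λ i j → t * δ i j - M i j

  infix 8 _·_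
  _·_ : ∀ {n} → Vector n → Vector n → Carrier
  u · v = ∑ λ i → u i * v i

  ·-comm : ∀ {n} (u v : Vector n) → u · v ≈ v · u
  ·-comm u v = ∑-cong λ i → *-comm (u i) (v i)

  IsSymmetric : ∀ {n} → Matrix n → Set
  IsSymmetric M = ∀ i j → M i j ≈ M j i

  -- Eigenvectors are taken on the left, to fit the row operations on determinants.
  Eigen : ∀ {n} → Matrix n → Carrier → Vector n → Set
  Eigen M μ v = ∀ c → ∑ (λ i → v i * M i c) ≈ μ * v c

  characteristic-row : ∀ {n} (M : Matrix n) t (v : Vector n) c →
    ∑ (λ i → v i * (t * δ i c - M i c)) ≈ t * v c - ∑ (λ i → v i * M i c)
  characteristic-row M t v c = begin
    ∑ (λ i → v i * (t * δ i c - M i c))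
      ≈⟨ ∑-cong (λ i → solve 4 (λ v t d m → v :* (t :* d :- m) := t :* (v :* d) :+ (:- con 1ℚ) :* (v :* m)) refl (v i) t (δ i c) (M i c)) ⟩
    ∑ (λ i → t * (v i * δ i c) + (- 1#) * (v i * M i c))
      ≈⟨ ∑-linear t (- 1#) _ _ ⟩
    t * ∑ (λ i → v i * δ i c) + (- 1#) * ∑ (λ i → v i * M i c)
      ≈⟨ +-cong (*-congˡ (∑-*δ v c)) (solve 1 (λ a → (:- con 1ℚ) :* a := :- a) refl _) ⟩
    t * v c - ∑ (λ i → v i * M i c) ∎

  module _ {n : ℕ} (M : Matrix n) (v : Vector n) where

    rank-one-update : Carrier → Matrix n
    rank-one-update s i c = M i c + s * (v i * v c)

    update-row : ∀ s w c → ∑ (λ i → w i * rank-one-update s i c) ≈ ∑ (λ i → w i * M i c) + (s * v c) * w · v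
    update-row s w c = begin
      ∑ (λ i → w i * rank-one-update s i c)
        ≈⟨ ∑-cong (λ i → solve 5 (λ w m s v x → w :* (m :+ s :* (v :* x)) := con 1ℚ :* (w :* m) :+ (s :* x) :* (w :* v)) refl (w i) (M i c) s (v i) (v c)) ⟩
      ∑ (λ i → 1# * (w i * M i c) + (s * v c) * (w i * v i))
        ≈⟨ ∑-linear 1# (s * v c) _ _ ⟩
      1# * ∑ (λ i → w i * M i c) + (s * v c) * w · v
        ≈⟨ +-congʳ (*-identityˡ _) ⟩
      ∑ (λ i → w i * M i c) + (s * v c) * w · v ∎

    update-eigen : ∀ {μ} s → Eigen M μ v → Eigen (rank-one-update s) (μ + s * v · v) v
    update-eigen {μ} s eig c = trans (update-row s v c) (trans (+-congʳ (eig c))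
      (solve 4 (λ m x s n → m :* x :+ (s :* x) :* n := (m :+ s :* n) :* x) refl μ (v c) s (v · v)))

    update-symmetric : ∀ s → IsSymmetric M → IsSymmetric (rank-one-update s)
    update-symmetric s M-sym i j = +-cong (M-sym i j) (*-congˡ (*-comm (v i) (v j)))

  -- One determinant is computed in two ways: row `p` of t - M is replaced by the combination of all
  -- its rows with coefficients `v`. As a row combination this scales the determinant by `v p`; by
  -- the eigenvalue equation the new row is (t - μ) v.
  charPoly-row : ∀ {n} (M : Matrix n) {μ v} p → Eigen M μ v → ∀ t →
                 v p * charPoly M t ≈ (t - μ) * det ((λ i j → t * δ i j - M i j) [ p ]≔ v)
  charPoly-row M {μ} {v} p eig t = begin
    v p * charPoly M t
      ≈⟨ det-row-combination X v p ⟨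
    det (X [ p ]≔ λ c → ∑ λ i → v i * X i c)
      ≈⟨ det-row-cong X p (λ c → trans (characteristic-row M t v c) (trans (+-congˡ (-‿cong (eig c)))
           (solve 3 (λ t m x → t :* x :- m :* x := (t :- m) :* x) refl t μ (v c)))) ⟩
    det (X [ p ]≔ λ c → (t - μ) * v c)
      ≈⟨ det-row-scale X p (t - μ) v ⟩
    (t - μ) * det (X [ p ]≔ v) ∎
    where
    X : Matrix _
    X i j = t * δ i j - M i j

  -- With row p of t - M replaced by the eigenvector v, the rank-one update only adds multiples of row p
  -- to the other rows; so both characteristic polynomials share the cofactor det ((t - M) [ p ]≔ v).
  deflate : ∀ {n} (M : Matrix n) {μ v Q} → (∃ λ (p : Fin n) → Unit (v p)) → Eigen M μ v →
            IsPoly Q → (∀ t → charPoly M t ≈ (t - μ) * Q t) →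
            ∀ s t → charPoly (rank-one-update M v s) t ≈ (t - (μ + s * v · v)) * Q t
  deflate {n} M {μ} {v} {Q} (p , y , vy≈1) eig Q-poly χ≈ s t = begin
    charPoly M′ t
      ≈⟨ *-identityˡ _ ⟨
    1# * charPoly M′ t
      ≈⟨ *-congʳ vy≈1 ⟨
    (v p * y) * charPoly M′ t
      ≈⟨ solve 3 (λ v y d → (v :* y) :* d := y :* (v :* d)) refl (v p) y _ ⟩
    y * (v p * charPoly M′ t)
      ≈⟨ *-congˡ (charPoly-row M′ p (update-eigen M v s eig) t) ⟩
    y * (ν * det (X M′ t [ p ]≔ v))
      ≈⟨ *-congˡ (*-congˡ (trans (same-cofactor t) (cofactor t))) ⟩
    y * (ν * (v p * Q t))
      ≈⟨ solve 4 (λ y n v q → y :* (n :* (v :* q)) := (v :* y) :* (n :* q)) refl y ν (v p) (Q t) ⟩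
    (v p * y) * (ν * Q t)
      ≈⟨ *-congʳ vy≈1 ⟩
    1# * (ν * Q t)
      ≈⟨ *-identityˡ _ ⟩
    ν * Q t ∎
    where
    M′ : Matrix n
    M′ = rank-one-update M v s

    ν : Carrier
    ν = t - (μ + s * v · v)

    X : Matrix n → Carrier → Matrix n
    X M t i j = t * δ i j - M i j

    same-cofactor : ∀ t → det (X M′ t [ p ]≔ v) ≈ det (X M t [ p ]≔ v)
    same-cofactor t = det-add-multiples (X M t [ p ]≔ v) (X M′ t [ p ]≔ v) (λ i → - (s * v i)) p
      (λ c → reflexive (≡.cong (λ f → f c) (≡.trans (lookup-≔ (X M′ t) p) (≡.sym (lookup-≔ (X M t) p)))))
      λ i i≢p c → begin
        (X M′ t [ p ]≔ v) i c
          ≡⟨ ≡.cong (λ f → f c) (lookup-≔-≢ (X M′ t) i≢p) ⟩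
        t * δ i c - (M i c + s * (v i * v c))
          ≈⟨ solve 5 (λ d m s v x → d :- (m :+ s :* (v :* x)) := (d :- m) :+ (:- (s :* v)) :* x) refl (t * δ i c) (M i c) s (v i) (v c) ⟩
        X M t i c + - (s * v i) * v c
          ≡⟨ ≡.cong₂ (λ f g → f c + - (s * v i) * g c) (lookup-≔-≢ (X M t) i≢p) (lookup-≔ (X M t) p) ⟨
        (X M t [ p ]≔ v) i c + - (s * v i) * (X M t [ p ]≔ v) p c ∎

    D : Carrier → Carrier
    D t = det (X M t [ p ]≔ v)

    D-poly : IsPoly D
    D-poly = isPoly-det _ entry
      where
      entry : ∀ i c → IsPoly (λ t → (X M t [ p ]≔ v) i c)
      entry i c with i Fin.≟ p
      ... | yes ≡.refl = isPoly-cong (λ t → reflexive (≡.cong (λ f → f c) (≡.sym (lookup-≔ (X M t) p)))) (isPoly-const (v c))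
      ... | no i≢p = isPoly-cong (λ t → reflexive (≡.cong (λ f → f c) (≡.sym (lookup-≔-≢ (X M t) i≢p))))
                                 (isPoly-linear (δ i c) (M i c))

    -- Multiplied by t - μ, both sides become `v p * charPoly M t`. The factor is cancelled between
    -- polynomial functions, so the identity survives at t = μ.
    cofactor : ∀ t → D t ≈ v p * Q t
    cofactor t = begin
      D t                                     ≈⟨ solve 2 (λ d q → d := (d :+ (:- q)) :+ q) refl (D t) (v p * Q t) ⟩
      (D t + - (v p * Q t)) + v p * Q t       ≈⟨ +-congʳ (+-congˡ (solve 2 (λ v q → :- (v :* q) := (:- v) :* q) refl (v p) (Q t))) ⟩
      (D t + (- v p) * Q t) + v p * Q t       ≈⟨ +-congʳ (poly-cancel μ
                                                   (isPoly-+ D-poly (isPoly-* (isPoly-const (- v p)) Q-poly)) vanishes t) ⟩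
      0# + v p * Q t                          ≈⟨ +-identityˡ _ ⟩
      v p * Q t                               ∎
      where
      vanishes : ∀ t → (t - μ) * (D t + (- v p) * Q t) ≈ 0#
      vanishes t = begin
        (t - μ) * (D t + (- v p) * Q t)
          ≈⟨ solve 4 (λ x d v q → x :* (d :+ (:- v) :* q) := x :* d :- v :* (x :* q)) refl (t - μ) (D t) (v p) (Q t) ⟩
        (t - μ) * D t - v p * ((t - μ) * Q t)
          ≈⟨ +-cong (sym (charPoly-row M p eig t)) (-‿cong (*-congˡ (sym (χ≈ t)))) ⟩
        v p * charPoly M t - v p * charPoly M t
          ≈⟨ -‿inverseʳ _ ⟩
        0# ∎

  -- Orthogonal systems of eigenvectors

  eigen-orthogonal : ∀ {n} (M : Matrix n) {a b v w} → IsSymmetric M → Eigen M a v → Eigen M b w →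
                     (a - b) * v · w ≈ 0#
  eigen-orthogonal M {a} {b} {v} {w} M-sym eig-v eig-w = begin
    (a - b) * v · w                     ≈⟨ solve 3 (λ a b x → (a :- b) :* x := a :* x :- b :* x) refl a b _ ⟩
    a * v · w - b * v · w               ≈⟨ +-cong left (-‿cong right) ⟩
    form - form                         ≈⟨ -‿inverseʳ _ ⟩
    0#                                  ∎
    where
    form : Carrier
    form = ∑ λ c → ∑ λ i → w c * (v i * M i c)
    left : a * v · w ≈ form
    left = begin
      a * v · w                              ≈⟨ *-∑ a _ ⟩
      ∑ (λ c → a * (v c * w c))              ≈⟨ ∑-cong (λ c → solve 3 (λ a v w → a :* (v :* w) := w :* (a :* v)) refl a (v c) (w c)) ⟩
      ∑ (λ c → w c * (a * v c))              ≈⟨ ∑-cong (λ c → *-congˡ (sym (eig-v c))) ⟩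
      ∑ (λ c → w c * ∑ (λ i → v i * M i c))  ≈⟨ ∑-cong (λ c → *-∑ (w c) _) ⟩
      form                                   ∎
    right : b * v · w ≈ form
    right = begin
      b * v · w                              ≈⟨ *-∑ b _ ⟩
      ∑ (λ i → b * (v i * w i))              ≈⟨ ∑-cong (λ i → solve 3 (λ b v w → b :* (v :* w) := v :* (b :* w)) refl b (v i) (w i)) ⟩
      ∑ (λ i → v i * (b * w i))              ≈⟨ ∑-cong (λ i → *-congˡ (sym (eig-w i))) ⟩
      ∑ (λ i → v i * ∑ (λ c → w c * M c i))  ≈⟨ ∑-cong (λ i → trans (*-∑ (v i) _) (∑-cong λ c →
        trans (*-congˡ (*-congˡ (M-sym c i))) (solve 3 (λ v w m → v :* (w :* m) := w :* (v :* m)) refl (v i) (w c) (M i c)))) ⟩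
      ∑ (λ i → ∑ λ c → w c * (v i * M i c))  ≈⟨ ∑-swap (λ i c → w c * (v i * M i c)) ⟩
      form                                   ∎

  -- The reciprocals `inv` of the squared norms replace normalisation. The number `m` of eigenvalues
  -- is kept apart from the dimension `n`, since deflation shortens the list of eigenvalues without
  -- shrinking the matrix.
  record Eigensystem {n m} (M : Matrix n) (μ : Vector m) : Set where
    field
      vec   : Fin m → Vector n
      inv   : Vector m
      norm  : ∀ j → vec j · vec j * inv j ≈ 1#
      orth  : ∀ {i j} → i ≢ j → vec i · vec j ≈ 0#
      eigen : ∀ j → Eigen M (μ j) (vec j)

  -- An eigenvector v for μ 0 is found, and its eigenvalue is moved to c, which is larger than all the others.
  -- The later eigenvectors, computed for the updated matrix, are thus orthogonal to v, hence eigenvectors of M.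
  spectral : ∀ {n} m (M : Matrix n) → IsSymmetric M → {R : Carrier → Carrier} → IsPoly R → (μ : Vector m) →
             (∀ t → charPoly M t ≈ R t * product (λ j → t - μ j)) →
             (c : Carrier) → (∀ j → 1# ≤ (c - μ j)) → ¬ ¬ Eigensystem M μ
  spectral zero    M M-sym R-poly μ χ≈ c gap = return (record
    { vec = λ () ; inv = λ () ; norm = λ () ; orth = λ { {()} } ; eigen = λ () })
  spectral {n} (suc m) M M-sym {R} R-poly μ χ≈ c gap =
    kernel (λ i j → μ zero * δ i j - M i j) root >>= λ (v , v-unit , v-kills) →
    zero-or-unit (v · v) >>= λ where
      (inj₁ vv≈0) → contradiction
        (square-zero (∑-nonNeg-zero (λ i → square-nonNeg (v i)) vv≈0 (proj₁ v-unit)))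
        (unit-nonzero (proj₂ v-unit))
      (inj₂ (u , vvu≈1)) → step v v-unit v-kills u vvu≈1
    where
    root : charPoly M (μ zero) ≈ 0#
    root = trans (χ≈ (μ zero)) (trans (*-congˡ (trans (*-congʳ (-‿inverseʳ _)) (zeroˡ _))) (zeroʳ _))

    P : Carrier → Carrier
    P t = product λ j → t - μ (suc j)

    step : ∀ v → (∃ λ (p : Fin n) → Unit (v p)) → (∀ j → ∑ (λ i → v i * (μ zero * δ i j - M i j)) ≈ 0#) →
           ∀ u → v · v * u ≈ 1# → ¬ ¬ Eigensystem M μ
    step v v-unit v-kills u vvu≈1 =
      -- The moved root joins the factor `R`, which thus accumulates the linear factors of all
      -- eigenvectors already found.
      spectral m M′ (update-symmetric M v s M-sym) (isPoly-* (isPoly-+ (2 , poly-id) (isPoly-const (- ν))) R-poly)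
        (μ ∘ suc) (λ t → trans (χ′≈ t) (sym (*-assoc _ _ _))) c (gap ∘ suc)
        >>= λ E → return (extend E)
      where
      s : Carrier
      s = (c - μ zero) * u

      M′ : Matrix n
      M′ = rank-one-update M v s

      ν : Carrier
      ν = μ zero + s * v · v

      ν≈c : ν ≈ c
      ν≈c = begin
        μ zero + ((c - μ zero) * u) * v · v
          ≈⟨ solve 4 (λ m c u n → m :+ ((c :- m) :* u) :* n := m :+ (c :- m) :* (n :* u)) refl (μ zero) c u (v · v) ⟩
        μ zero + (c - μ zero) * (v · v * u)
          ≈⟨ +-congˡ (*-congˡ vvu≈1) ⟩
        μ zero + (c - μ zero) * 1#
          ≈⟨ solve 2 (λ m c → m :+ (c :- m) :* con 1ℚ := c) refl (μ zero) c ⟩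
        c ∎

      v-eigen : Eigen M (μ zero) v
      v-eigen j = begin
        ∑ (λ i → v i * M i j)
          ≈⟨ solve 2 (λ a b → b := a :- (a :- b)) refl (μ zero * v j) _ ⟩
        μ zero * v j - (μ zero * v j - ∑ (λ i → v i * M i j))
          ≈⟨ +-congˡ (-‿cong (trans (sym (characteristic-row M (μ zero) v j)) (v-kills j))) ⟩
        μ zero * v j - 0#
          ≈⟨ solve 1 (λ a → a :- con 0ℚ := a) refl _ ⟩
        μ zero * v j ∎

      χ′≈ : ∀ t → charPoly M′ t ≈ (t - ν) * (R t * P t)
      χ′≈ = deflate M v-unit v-eigen (isPoly-* R-poly (isPoly-∏ (μ ∘ suc)))
        (λ t → trans (χ≈ t) (solve 3 (λ r x p → r :* (x :* p) := x :* (r :* p)) refl (R t) (t - μ zero) (P t))) s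

      extend : Eigensystem M′ (μ ∘ suc) → Eigensystem M μ
      extend E = record
        { vec   = v ◂ E.vec
        ; inv   = u ◂ E.inv
        ; norm  = λ { zero → vvu≈1 ; (suc j) → E.norm j }
        ; orth  = orth
        ; eigen = λ { zero → v-eigen ; (suc j) → eigen j }
        }
        where
        module E = Eigensystem E
        v⊥ : ∀ j → v · E.vec j ≈ 0#
        -- Orthogonality is read off `M′`, where `v` belongs to `c` and `E.vec j` to `μ (suc j)`;
        -- these are at least 1 apart even when `μ (suc j)` equals `μ zero`.
        v⊥ j = cancel-≥1 (≤.trans (gap (suc j)) (≤.reflexive (+-congʳ (sym ν≈c))))
          (eigen-orthogonal M′ (update-symmetric M v s M-sym) (update-eigen M v s v-eigen) (E.eigen j))
        orth : ∀ {i j} → i ≢ j → (v ◂ E.vec) i · (v ◂ E.vec) j ≈ 0#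
        orth {zero}  {zero}  i≢j = contradiction ≡.refl i≢j
        orth {zero}  {suc j} i≢j = v⊥ j
        orth {suc i} {zero}  i≢j = trans (·-comm (E.vec i) v) (v⊥ i)
        orth {suc i} {suc j} i≢j = E.orth (i≢j ∘ ≡.cong suc)
        eigen : ∀ j → Eigen M (μ (suc j)) (E.vec j)
        eigen j k = begin
          ∑ (λ i → w i * M i k)
            ≈⟨ solve 2 (λ a b → a := a :+ b :* con 0ℚ) refl _ (s * v k) ⟩
          ∑ (λ i → w i * M i k) + (s * v k) * 0#
            ≈⟨ +-congˡ (*-congˡ (trans (·-comm w v) (v⊥ j))) ⟨
          ∑ (λ i → w i * M i k) + (s * v k) * w · v
            ≈⟨ update-row M v s w k ⟨
          ∑ (λ i → w i * M′ i k)
            ≈⟨ E.eigen j k ⟩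
          μ (suc j) * w k ∎
          where
          w : Vector n
          w = E.vec j

  -- n orthogonal non-isotropic vectors in dimension n: the projection P onto their span has trace n,
  -- so that the sum of the squared entries of δ - P is trace (δ - P) = 0.
  completeness : ∀ {n} {M : Matrix n} {μ : Vector n} (E : Eigensystem M μ) → let open Eigensystem E in
                 ∀ a b → ∑ (λ j → inv j * (vec j a * vec j b)) ≈ δ a b
  completeness {n} E a b = begin
    P a b                        ≈⟨ solve 2 (λ p d → p := d :- (d :- p)) refl (P a b) (δ a b) ⟩
    δ a b - (δ a b - P a b)      ≈⟨ +-congˡ (-‿cong (square-zero (∑-nonNeg-zero (λ b → square-nonNeg _)
                                      (∑-nonNeg-zero (λ a → ∑-nonNeg λ b → square-nonNeg _) total a) b))) ⟩
    δ a b - 0#                   ≈⟨ solve 1 (λ d → d :- con 0ℚ := d) refl (δ a b) ⟩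
    δ a b                        ∎
    where
    open Eigensystem E
    P : Matrix n
    P a b = ∑ λ j → inv j * (vec j a * vec j b)

    P-fixes : ∀ k a → ∑ (λ b → P a b * vec k b) ≈ vec k a
    P-fixes k a = begin
      ∑ (λ b → P a b * vec k b)
        ≈⟨ ∑-cong (λ b → trans (*-comm _ _) (trans (*-∑ (vec k b) _) (∑-cong λ j →
             solve 4 (λ w u x y → w :* (u :* (x :* y)) := (u :* x) :* (y :* w)) refl (vec k b) (inv j) (vec j a) (vec j b)))) ⟩
      ∑ (λ b → ∑ λ j → (inv j * vec j a) * (vec j b * vec k b))
        ≈⟨ ∑-swap (λ b j → (inv j * vec j a) * (vec j b * vec k b)) ⟩
      ∑ (λ j → ∑ λ b → (inv j * vec j a) * (vec j b * vec k b))
        ≈⟨ ∑-cong (λ j → sym (*-∑ (inv j * vec j a) _)) ⟩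
      ∑ (λ j → (inv j * vec j a) * vec j · vec k)
        ≈⟨ ∑-single k (λ j j≢k → trans (*-congˡ (orth j≢k)) (zeroʳ _)) ⟩
      (inv k * vec k a) * vec k · vec k
        ≈⟨ solve 3 (λ u x n → (u :* x) :* n := (n :* u) :* x) refl (inv k) (vec k a) (vec k · vec k) ⟩
      (vec k · vec k * inv k) * vec k a
        ≈⟨ trans (*-congʳ (norm k)) (*-identityˡ _) ⟩
      vec k a ∎

    row-norm : ∀ a → ∑ (λ b → P a b * P a b) ≈ P a a
    row-norm a = begin
      ∑ (λ b → P a b * P a b)
        ≈⟨ ∑-cong (λ b → trans (*-∑ (P a b) _) (∑-cong λ k →
             solve 4 (λ p u x y → p :* (u :* (x :* y)) := (u :* x) :* (p :* y)) refl (P a b) (inv k) (vec k a) (vec k b))) ⟩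
      ∑ (λ b → ∑ λ k → (inv k * vec k a) * (P a b * vec k b))
        ≈⟨ ∑-swap (λ b k → (inv k * vec k a) * (P a b * vec k b)) ⟩
      ∑ (λ k → ∑ λ b → (inv k * vec k a) * (P a b * vec k b))
        ≈⟨ ∑-cong (λ k → trans (sym (*-∑ (inv k * vec k a) _)) (trans (*-congˡ (P-fixes k a)) (*-assoc _ _ _))) ⟩
      P a a ∎

    trace-P : ∑ (λ a → P a a) ≈ ∑ {n} λ _ → 1#
    trace-P = trans (∑-swap (λ a j → inv j * (vec j a * vec j a))) (∑-cong λ j →
      trans (sym (*-∑ (inv j) _)) (trans (*-comm _ _) (norm j)))

    row : ∀ a → ∑ (λ b → (δ a b - P a b) * (δ a b - P a b)) ≈ 1# - P a a
    row a = begin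
      ∑ (λ b → (δ a b - P a b) * (δ a b - P a b))
        -- The square is arranged so that the factor `δ a b` picks out one entry of the sum, and the
        -- rest is `row-norm`.
        ≈⟨ ∑-cong (λ b → solve 2 (λ d p → (d :- p) :* (d :- p) := d :* (d :- p :- p) :+ p :* p) refl (δ a b) (P a b)) ⟩
      ∑ (λ b → δ a b * (δ a b - P a b - P a b) + P a b * P a b)
        ≈⟨ ∑-+ _ _ ⟩
      ∑ (λ b → δ a b * (δ a b - P a b - P a b)) + ∑ (λ b → P a b * P a b)
        ≈⟨ +-cong (trans (∑-δ* a (λ b → δ a b - P a b - P a b)) (+-congʳ (+-congʳ (δ-diagonal a)))) (row-norm a) ⟩
      (1# - P a a - P a a) + P a a
        ≈⟨ solve 2 (λ o p → (o :- p :- p) :+ p := o :- p) refl 1# (P a a) ⟩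
      1# - P a a ∎

    total : ∑ (λ a → ∑ λ b → (δ a b - P a b) * (δ a b - P a b)) ≈ 0#
    total = begin
      ∑ (λ a → ∑ λ b → (δ a b - P a b) * (δ a b - P a b))
        ≈⟨ ∑-cong (λ a → trans (row a) (solve 2 (λ o p → o :- p := con 1ℚ :* o :+ (:- con 1ℚ) :* p) refl 1# (P a a))) ⟩
      ∑ (λ a → 1# * 1# + (- 1#) * P a a)
        ≈⟨ ∑-linear 1# (- 1#) _ _ ⟩
      1# * ∑ {n} (λ _ → 1#) + (- 1#) * ∑ (λ a → P a a)
        ≈⟨ +-congˡ (*-congˡ trace-P) ⟩
      1# * ∑ {n} (λ _ → 1#) + (- 1#) * ∑ {n} (λ _ → 1#)
        ≈⟨ solve 1 (λ x → con 1ℚ :* x :+ (:- con 1ℚ) :* x := con 0ℚ) refl _ ⟩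
      0# ∎

  -- Ky Fan's inequality

  ∑-mono : ∀ {n} {f g : Vector n} → (∀ i → f i ≤ g i) → ∑ f ≤ ∑ g
  ∑-mono {zero}  h = ≤.reflexive (trans (∑-empty _) (sym (∑-empty _)))
  ∑-mono {suc n} h = ≤.trans (≤.reflexive (∑-suc _))
    (≤.trans (+-mono-≤ (h zero) (∑-mono (h ∘ suc))) (≤.reflexive (sym (∑-suc _))))

  -- The bathtub principle: weights between 0 and 1 do best when they are 1 where `g` is nonnegative
  -- and 0 where it is nonpositive.
  weighted-sum≤ : ∀ {n} k (k≤n : k ℕ.≤ n) (g w : Vector n) → (∀ j → 0# ≤ w j) → (∀ j → w j ≤ 1#) →
                  (∀ j → toℕ j ℕ.< k → 0# ≤ g j) → (∀ j → k ℕ.≤ toℕ j → g j ≤ 0#) →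
                  ∑ (λ j → g j * w j) ≤ ∑ (λ i → g (inject≤ i k≤n))
  weighted-sum≤ zero    _   g w 0≤w w≤1 _  g≤0 = ≤.trans
    (∑-mono λ j → ≤.trans (≤.reflexive (*-comm _ _)) (≤.trans (*-monoˡ-≤ (0≤w j) (g≤0 j z≤n)) (≤.reflexive (zeroʳ _))))
    (≤.reflexive (trans (∑-zero λ _ → refl) (sym (∑-empty _))))
  weighted-sum≤ {suc n} (suc k) k≤n g w 0≤w w≤1 0≤g g≤0 = ≤.trans (≤.reflexive (∑-suc _)) (≤.trans
    (+-mono-≤ (≤.trans (*-monoˡ-≤ (0≤g zero (s≤s z≤n)) (w≤1 zero)) (≤.reflexive (*-identityʳ _)))
              (weighted-sum≤ k (ℕ.s≤s⁻¹ k≤n) (g ∘ suc) (w ∘ suc) (0≤w ∘ suc) (w≤1 ∘ suc)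
                (λ j j<k → 0≤g (suc j) (s≤s j<k)) (λ j k≤j → g≤0 (suc j) (s≤s k≤j))))
    (≤.reflexive (sym (∑-suc _))))

  module _ {n : ℕ} (Q : Matrix n) where

    -- This is the trace of `Q X`. Its linearity in `X` lets the spectral decompositions of `M` and
    -- of the identity be inserted.
    pairing : Matrix n → Carrier
    pairing X = ∑ λ a → ∑ λ b → Q a b * X b a

    pairing-cong : ∀ {X Y} → (∀ b a → X b a ≈ Y b a) → pairing X ≈ pairing Y
    pairing-cong X≈Y = ∑-cong λ a → ∑-cong λ b → *-congˡ (X≈Y b a)

    pairing-∑ : ∀ {m} (c : Vector m) (Y : Fin m → Matrix n) →
                pairing (λ b a → ∑ λ j → c j * Y j b a) ≈ ∑ λ j → c j * pairing (Y j)
    pairing-∑ c Y = begin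
      ∑ (λ a → ∑ λ b → Q a b * ∑ λ j → c j * Y j b a)
        ≈⟨ ∑-cong (λ a → ∑-cong λ b → trans (*-∑ (Q a b) _) (∑-cong λ j →
             solve 3 (λ q c y → q :* (c :* y) := c :* (q :* y)) refl (Q a b) (c j) (Y j b a))) ⟩
      ∑ (λ a → ∑ λ b → ∑ λ j → c j * (Q a b * Y j b a))
        ≈⟨ ∑-cong (λ a → ∑-swap (λ b j → c j * (Q a b * Y j b a))) ⟩
      ∑ (λ a → ∑ λ j → ∑ λ b → c j * (Q a b * Y j b a))
        ≈⟨ ∑-swap (λ a j → ∑ λ b → c j * (Q a b * Y j b a)) ⟩
      ∑ (λ j → ∑ λ a → ∑ λ b → c j * (Q a b * Y j b a))
        ≈⟨ ∑-cong (λ j → trans (∑-cong λ a → sym (*-∑ (c j) _)) (sym (*-∑ (c j) _))) ⟩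
      ∑ (λ j → c j * pairing (Y j)) ∎

    module _ (Q-sym : IsSymmetric Q) (Q-idem : ∀ a c → ∑ (λ b → Q a b * Q b c) ≈ Q a c) (v : Vector n) where

      form : Carrier
      form = pairing λ b a → v b * v a

      image : Vector n
      image a = ∑ λ b → Q a b * v b

      form≈v·image : form ≈ v · image
      form≈v·image = ∑-cong λ a → trans
        (∑-cong λ b → solve 3 (λ q x y → q :* (x :* y) := y :* (q :* x)) refl (Q a b) (v b) (v a))
        (sym (*-∑ (v a) _))

      image-fixed : ∀ a → ∑ (λ b → Q a b * image b) ≈ image a
      image-fixed a = begin
        ∑ (λ b → Q a b * image b)
          ≈⟨ ∑-cong (λ b → trans (*-∑ (Q a b) _) (∑-cong λ c →
               solve 3 (λ p q x → p :* (q :* x) := x :* (p :* q)) refl (Q a b) (Q b c) (v c))) ⟩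
        ∑ (λ b → ∑ λ c → v c * (Q a b * Q b c))
          ≈⟨ ∑-swap (λ b c → v c * (Q a b * Q b c)) ⟩
        ∑ (λ c → ∑ λ b → v c * (Q a b * Q b c))
          ≈⟨ ∑-cong (λ c → trans (sym (*-∑ (v c) _)) (trans (*-congˡ (Q-idem a c)) (*-comm _ _))) ⟩
        image a ∎

      form≈image·image : form ≈ image · image
      form≈image·image = begin
        form
          ≈⟨ form≈v·image ⟩
        ∑ (λ a → v a * image a)
          ≈⟨ ∑-cong (λ a → trans (*-congˡ (sym (image-fixed a))) (*-∑ (v a) _)) ⟩
        ∑ (λ a → ∑ λ b → v a * (Q a b * image b))
          ≈⟨ ∑-swap (λ a b → v a * (Q a b * image b)) ⟩
        ∑ (λ b → ∑ λ a → v a * (Q a b * image b))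
          ≈⟨ ∑-cong (λ b → trans (∑-cong λ a → trans (*-congˡ (*-congʳ (Q-sym a b)))
               (solve 3 (λ v q i → v :* (q :* i) := i :* (q :* v)) refl (v a) (Q b a) (image b))) (sym (*-∑ (image b) _))) ⟩
        image · image ∎

      form-nonNeg : 0# ≤ form
      form-nonNeg = ≤.trans (∑-nonNeg λ a → square-nonNeg (image a)) (≤.reflexive (sym form≈image·image))

      -- The difference of the two sides is the squared length of v - Qv.
      form≤norm : form ≤ v · v
      form≤norm = -‿nonNeg⁻¹ (≤.trans (∑-nonNeg λ a → square-nonNeg (v a - image a)) (≤.reflexive (begin
        ∑ (λ a → (v a - image a) * (v a - image a))
          ≈⟨ ∑-cong (λ a → solve 2 (λ v i → (v :- i) :* (v :- i) :=
               con 1ℚ :* (con 1ℚ :* (v :* v) :+ (:- (con 1ℚ :+ con 1ℚ)) :* (v :* i)) :+ con 1ℚ :* (i :* i)) refl (v a) (image a)) ⟩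
        ∑ (λ a → 1# * (1# * (v a * v a) + (- (1# + 1#)) * (v a * image a)) + 1# * (image a * image a))
          ≈⟨ trans (∑-linear 1# 1# _ _) (+-congʳ (*-congˡ (∑-linear 1# (- (1# + 1#)) _ _))) ⟩
        1# * (1# * v · v + (- (1# + 1#)) * v · image) + 1# * image · image
          ≈⟨ +-cong (*-congˡ (+-congˡ (*-congˡ (sym form≈v·image)))) (*-congˡ (sym form≈image·image)) ⟩
        1# * (1# * v · v + (- (1# + 1#)) * form) + 1# * form
          ≈⟨ solve 2 (λ n q → con 1ℚ :* (con 1ℚ :* n :+ (:- (con 1ℚ :+ con 1ℚ)) :* q) :+ con 1ℚ :* q := n :- q) refl (v · v) form ⟩
        v · v - form ∎)))

  -- For a projection the rank is the trace, so the last hypothesis fixes the rank. It is written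
  -- `suc k` so that a smallest summed eigenvalue exists, the threshold `θ` of the proof.
  kyFan : ∀ {n} (M : Matrix n) → IsSymmetric M → (μ : Vector n) → (∀ i j → i Fin.≤ j → μ j ≤ μ i) →
          (∀ t → charPoly M t ≈ product (λ j → t - μ j)) →
          (Q : Matrix n) → IsSymmetric Q → (∀ a c → ∑ (λ b → Q a b * Q b c) ≈ Q a c) →
          ∀ k (k<n : k ℕ.< n) → ∑ (λ a → Q a a) ≈ ∑ {suc k} (λ _ → 1#) →
          ∑ (λ a → ∑ λ b → Q a b * M b a) ≤ ∑ (λ i → μ (inject≤ i k<n))
  kyFan {suc n} M M-sym μ descending χ≈ Q Q-sym Q-idem k k<n trace-Q = ≤-stable
    -- The target of the deflation lies 1 above the largest eigenvalue; the accumulated factor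
    -- starts as 1.
    (spectral (suc n) M M-sym (isPoly-const 1#) μ (λ t → trans (χ≈ t) (sym (*-identityˡ _))) (μ zero + 1#)
       (λ j → ≤.trans (≤.reflexive (sym (+-identityˡ 1#))) (≤.trans (+-mono-≤ (-‿nonNeg (descending zero j z≤n)) ≤.refl)
         (≤.reflexive (solve 3 (λ m x o → (m :- x) :+ o := (m :+ o) :- x) refl (μ zero) (μ j) 1#))))
     >>= λ E → return (bound E))
    where
    bound : Eigensystem M μ → ∑ (λ a → ∑ λ b → Q a b * M b a) ≤ ∑ (λ i → μ (inject≤ i k<n))
    bound E = ≤.trans (≤.reflexive (begin
        pairing Q M
          ≈⟨ pairing-cong Q decompose ⟩
        pairing Q (λ b a → ∑ λ j → (μ j * inv j) * (vec j b * vec j a))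
          ≈⟨ pairing-∑ Q (λ j → μ j * inv j) (λ j b a → vec j b * vec j a) ⟩
        ∑ (λ j → (μ j * inv j) * q j)
          -- All eigenvalues are lowered by `θ`, the last one in the sum. Since the weights add up
          -- to `suc k`, this lowers both sides of the inequality equally, and afterwards the sign
          -- of each `μ j - θ` is known.
          ≈⟨ ∑-cong (λ j → solve 4 (λ m u q t → (m :* u) :* q := con 1ℚ :* ((m :- t) :* (u :* q)) :+ t :* (u :* q)) refl (μ j) (inv j) (q j) θ) ⟩
        ∑ (λ j → 1# * ((μ j - θ) * w j) + θ * w j)
          ≈⟨ ∑-linear 1# θ _ _ ⟩
        1# * ∑ (λ j → (μ j - θ) * w j) + θ * ∑ w
          ≈⟨ +-cong (*-identityˡ _) (*-congˡ total-weight) ⟩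
        ∑ (λ j → (μ j - θ) * w j) + θ * ∑ {suc k} (λ _ → 1#) ∎))
      (≤.trans (+-mono-≤ (weighted-sum≤ (suc k) k<n (λ j → μ j - θ) w 0≤w w≤1 above below) ≤.refl)
        (≤.reflexive (begin
          ∑ (λ i → μ (inject≤ i k<n) - θ) + θ * ∑ {suc k} (λ _ → 1#)
            ≈⟨ +-cong (sym (*-identityˡ _)) refl ⟩
          1# * ∑ (λ i → μ (inject≤ i k<n) - θ) + θ * ∑ {suc k} (λ _ → 1#)
            ≈⟨ ∑-linear 1# θ _ _ ⟨
          ∑ (λ i → 1# * (μ (inject≤ i k<n) - θ) + θ * 1#)
            ≈⟨ ∑-cong (λ i → solve 2 (λ m t → con 1ℚ :* (m :- t) :+ t :* con 1ℚ := m) refl (μ (inject≤ i k<n)) θ) ⟩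
          ∑ (λ i → μ (inject≤ i k<n)) ∎)))
      where
      open Eigensystem E

      last : Fin (suc n)
      last = fromℕ< k<n

      θ : Carrier
      θ = μ last

      q w : Vector (suc n)
      q j = form Q Q-sym Q-idem (vec j)
      w j = inv j * q j

      0≤inv : ∀ j → 0# ≤ inv j
      -- A reciprocal is its own square times the number it inverts, here a sum of squares.
      0≤inv j = ≤.trans (*-nonNeg (square-nonNeg (inv j)) (∑-nonNeg λ i → square-nonNeg (vec j i)))
        (≤.reflexive (trans (solve 2 (λ u n → (u :* u) :* n := u :* (n :* u)) refl (inv j) (vec j · vec j))
          (trans (*-congˡ (norm j)) (*-identityʳ _))))

      0≤w : ∀ j → 0# ≤ w j
      0≤w j = *-nonNeg (0≤inv j) (form-nonNeg Q Q-sym Q-idem (vec j))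

      w≤1 : ∀ j → w j ≤ 1#
      w≤1 j = ≤.trans (*-monoˡ-≤ (0≤inv j) (form≤norm Q Q-sym Q-idem (vec j)))
                      (≤.reflexive (trans (*-comm _ _) (norm j)))

      total-weight : ∑ w ≈ ∑ {suc k} λ _ → 1#
      total-weight = begin
        ∑ w                                                          ≈⟨ pairing-∑ Q inv (λ j b a → vec j b * vec j a) ⟨
        pairing Q (λ b a → ∑ λ j → inv j * (vec j b * vec j a))      ≈⟨ pairing-cong Q (completeness E) ⟩
        pairing Q δ                                                  ≈⟨ ∑-cong (λ a → ∑-*δ (Q a) a) ⟩
        ∑ (λ a → Q a a)                                              ≈⟨ trace-Q ⟩
        ∑ {suc k} (λ _ → 1#)                                         ∎

      decompose : ∀ b a → M b a ≈ ∑ λ j → (μ j * inv j) * (vec j b * vec j a)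
      decompose b a = begin
        M b a
          ≈⟨ ∑-δ* b (λ i → M i a) ⟨
        ∑ (λ i → δ b i * M i a)
          ≈⟨ ∑-cong (λ i → trans (*-congʳ (sym (completeness E b i))) (trans (*-comm _ _) (trans (*-∑ (M i a) _)
               (∑-cong λ j → solve 4 (λ m u x y → m :* (u :* (x :* y)) := (u :* x) :* (y :* m)) refl (M i a) (inv j) (vec j b) (vec j i))))) ⟩
        ∑ (λ i → ∑ λ j → (inv j * vec j b) * (vec j i * M i a))
          ≈⟨ ∑-swap (λ i j → (inv j * vec j b) * (vec j i * M i a)) ⟩
        ∑ (λ j → ∑ λ i → (inv j * vec j b) * (vec j i * M i a))
          ≈⟨ ∑-cong (λ j → trans (sym (*-∑ (inv j * vec j b) _)) (trans (*-congˡ (eigen j a))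
               (solve 4 (λ u x m y → (u :* x) :* (m :* y) := (m :* u) :* (x :* y)) refl (inv j) (vec j b) (μ j) (vec j a)))) ⟩
        ∑ (λ j → (μ j * inv j) * (vec j b * vec j a)) ∎

      above : ∀ j → toℕ j ℕ.< suc k → 0# ≤ (μ j - θ)
      above j j≤k = -‿nonNeg (descending j last (≡.subst (toℕ j ℕ.≤_) (≡.sym (Fin.toℕ-fromℕ< k<n)) (ℕ.s≤s⁻¹ j≤k)))

      below : ∀ j → suc k ℕ.≤ toℕ j → (μ j - θ) ≤ 0#
      below j k<j = ≤.trans (+-mono-≤ (descending last j
        (≡.subst (ℕ._≤ toℕ j) (≡.sym (Fin.toℕ-fromℕ< k<n)) (ℕ.<⇒≤ k<j))) ≤.refl) (≤.reflexive (-‿inverseʳ θ))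

-- Degrees and edge cuts as sums over the adjacency matrix

/1-suc : ∀ m → + suc m ℚ./ 1 ≡ 1ℚ ℚ.+ + m ℚ./ 1
/1-suc m = ℚ.toℚᵘ-injective (ℚᵘ.≃-trans (ℚ.toℚᵘ-fromℚᵘ (ℚᵘ.mkℚᵘ (+ suc m) 0)) (ℚᵘ.≃-sym
  (ℚᵘ.≃-trans (ℚ.toℚᵘ-homo-+ 1ℚ (+ m ℚ./ 1)) (ℚᵘ.≃-trans
    (ℚᵘ.+-congʳ ℚᵘ.1ℚᵘ (ℚ.toℚᵘ-fromℚᵘ (ℚᵘ.mkℚᵘ (+ m) 0)))
    (ℚᵘ.*≡* (≡.cong (λ i → (+ 1 ℤ.+ i) ℤ.* + 1) (ℤ.*-identityʳ (+ m))))))))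

1/n*n/1 : ∀ m → (+ 1 ℚ./ suc m) ℚ.* (+ suc m ℚ./ 1) ≡ 1ℚ
1/n*n/1 m = ℚ.toℚᵘ-injective (ℚᵘ.≃-trans (ℚ.toℚᵘ-homo-* (+ 1 ℚ./ suc m) (+ suc m ℚ./ 1)) (ℚᵘ.≃-trans
  (ℚᵘ.*-cong (ℚ.toℚᵘ-fromℚᵘ (ℚᵘ.mkℚᵘ (+ 1) m)) (ℚ.toℚᵘ-fromℚᵘ (ℚᵘ.mkℚᵘ (+ suc m) 0)))
  (ℚᵘ.*≡* (≡.trans (ℤ.*-identityʳ _) (≡.trans (ℤ.*-identityˡ (+ suc m))
    (≡.sym (≡.trans (ℤ.*-identityˡ _) (≡.cong +_ (ℕ.*-identityʳ (suc m))))))))))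

module GraphBound (F : OrderedAlgebra) where
  open LinearAlgebra F

  opaque
    ι : ℕ → Carrier
    ι m = ⟦ + m ℚ./ 1 ⟧

    ι≈⟦⟧ : ∀ m → ι m ≈ ⟦ + m ℚ./ 1 ⟧
    ι≈⟦⟧ m = refl

    ι-zero : ι 0 ≈ 0#
    ι-zero = 0-homo

    ι-suc : ∀ m → ι (suc m) ≈ 1# + ι m
    ι-suc m = trans (reflexive (≡.cong ⟦_⟧ (/1-suc m))) (trans (+-homo 1ℚ _) (+-congʳ 1-homo))

  ι-+ : ∀ m n → ι (m ℕ.+ n) ≈ ι m + ι n
  ι-+ zero    n = sym (trans (+-congʳ ι-zero) (+-identityˡ _))
  ι-+ (suc m) n = trans (ι-suc _) (trans (+-congˡ (ι-+ m n)) (trans (sym (+-assoc _ _ _)) (+-congʳ (sym (ι-suc m)))))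

  ι-double : ∀ m → ι (2 ℕ.* m) ≈ ι m + ι m
  ι-double m = trans (ι-+ m _) (+-congˡ (reflexive (≡.cong ι (ℕ.+-identityʳ m))))

  ∑-const-1 : ∀ n → ∑ {n} (λ _ → 1#) ≈ ι n
  ∑-const-1 zero    = trans (∑-empty _) (sym ι-zero)
  ∑-const-1 (suc n) = trans (∑-suc _) (trans (+-congˡ (∑-const-1 n)) (sym (ι-suc n)))

  -- Indicator values and sums over lists

  indicator : Bool → Carrier
  indicator b = if b then 1# else 0#

  indicator-∧ : ∀ x y → indicator (x ∧ y) ≈ indicator x * indicator y
  indicator-∧ true  y = sym (*-identityˡ _)
  indicator-∧ false y = sym (zeroˡ _)

  indicator-not : ∀ x → indicator (not x) ≈ 1# - indicator x
  indicator-not true  = sym (-‿inverseʳ 1#)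
  indicator-not false = solve 0 (con 1ℚ := con 1ℚ :- con 0ℚ) refl

  module _ {A : Set} where

    sumOver : (A → Carrier) → List A → Carrier
    sumOver g = List.foldr (λ x s → g x + s) 0#

    sumOver-cong : ∀ {g h} → (∀ x → g x ≈ h x) → ∀ xs → sumOver g xs ≈ sumOver h xs
    sumOver-cong g≈h []       = refl
    sumOver-cong g≈h (x ∷ xs) = +-cong (g≈h x) (sumOver-cong g≈h xs)

    sumOver-++ : ∀ g xs ys → sumOver g (xs ++ ys) ≈ sumOver g xs + sumOver g ys
    sumOver-++ g []       ys = sym (+-identityˡ _)
    sumOver-++ g (x ∷ xs) ys = trans (+-congˡ (sumOver-++ g xs ys)) (sym (+-assoc _ _ _))

    sumOver-filter : ∀ {P : Pred A 0ℓ} (P? : Decidable P) g xs →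
                     sumOver g (filter P? xs) ≈ sumOver (λ x → indicator (does (P? x)) * g x) xs
    sumOver-filter P? g []       = refl
    sumOver-filter P? g (x ∷ xs) with does (P? x)
    ... | true  = +-cong (sym (*-identityˡ _)) (sumOver-filter P? g xs)
    ... | false = trans (sumOver-filter P? g xs) (sym (trans (+-congʳ (zeroˡ _)) (+-identityˡ _)))

    sumOver-tabulate : ∀ g {n} (f : Fin n → A) → sumOver g (List.tabulate f) ≈ ∑ (g ∘ f)
    sumOver-tabulate g {zero}  f = sym (∑-empty _)
    sumOver-tabulate g {suc n} f = trans (+-congˡ (sumOver-tabulate g (f ∘ suc))) (sym (∑-suc _))

    ι-length : ∀ (xs : List A) → ι (length xs) ≈ sumOver (λ _ → 1#) xs
    ι-length []       = ι-zero
    ι-length (x ∷ xs) = trans (ι-suc _) (+-congˡ (ι-length xs))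

    ι-sum : ∀ (f : A → ℕ) xs → ι (ListAction.sum (List.map f xs)) ≈ sumOver (ι ∘ f) xs
    ι-sum f []       = ι-zero
    ι-sum f (x ∷ xs) = trans (ι-+ (f x) _) (+-congˡ (ι-sum f xs))

  sumOver-map : ∀ {A B : Set} (g : B → Carrier) (f : A → B) xs → sumOver g (List.map f xs) ≈ sumOver (g ∘ f) xs
  sumOver-map g f []       = refl
  sumOver-map g f (x ∷ xs) = +-congˡ (sumOver-map g f xs)

  sumOver-cartesianProduct : ∀ {A B : Set} (g : A × B → Carrier) (xs : List A) (ys : List B) →
    sumOver g (cartesianProduct xs ys) ≈ sumOver (λ x → sumOver (λ y → g (x , y)) ys) xs
  sumOver-cartesianProduct g []       ys = refl
  sumOver-cartesianProduct g (x ∷ xs) ys = trans (sumOver-++ g (List.map (x ,_) ys) _)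
    (+-cong (sumOver-map g (x ,_) ys) (sumOver-cartesianProduct g xs ys))

  -- Indicator vectors of vertex sets

  χ : ∀ {n} → Subset n → Vector n
  χ U u = indicator (does (u ∈? U))

  ∑-χ : ∀ {n} (U : Subset n) → ∑ (χ U) ≈ ι ∣ U ∣
  ∑-χ []          = trans (∑-empty _) (sym ι-zero)
  ∑-χ (true  ∷ U) = trans (∑-suc _) (trans (+-congˡ (∑-χ U)) (sym (ι-suc _)))
  ∑-χ (false ∷ U) = trans (∑-suc _) (trans (+-identityˡ _) (∑-χ U))

  ∈?-∁ : ∀ {n} (U : Subset n) u → does (u ∈? ∁ U) ≡ not (does (u ∈? U))
  ∈?-∁ (true  ∷ U) zero    = ≡.refl
  ∈?-∁ (false ∷ U) zero    = ≡.refl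
  ∈?-∁ (_     ∷ U) (suc u) = ∈?-∁ U u

  χ-∁ : ∀ {n} (U : Subset n) u → χ (∁ U) u ≈ 1# - χ U u
  χ-∁ U u = trans (reflexive (≡.cong indicator (∈?-∁ U u))) (indicator-not (does (u ∈? U)))

  χ-idem : ∀ {n} (U : Subset n) u → χ U u * χ U u ≈ χ U u
  χ-idem U u with does (u ∈? U)
  ... | true  = *-identityˡ _
  ... | false = zeroˡ _

  χ*χ-∁ : ∀ {n} (U : Subset n) u → χ U u * χ (∁ U) u ≈ 0#
  χ*χ-∁ U u = trans (*-congˡ (χ-∁ U u)) (trans (solve 1 (λ x → x :* (con 1ℚ :- x) := x :- x :* x) refl (χ U u))
    (trans (+-congˡ (-‿cong (χ-idem U u))) (-‿inverseʳ _)))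

  -- Double counting of edges

  module Counting {n : ℕ} (G : Graph n) where
    open Graph G

    adjacency : Matrix n
    adjacency u v = indicator (does (adj? u v))

    Aα : Carrier → Matrix n
    Aα α u v = α * (ι (degree G u) * δ u v) + (1# - α) * adjacency u v

    adjacency-sym : IsSymmetric adjacency
    adjacency-sym u v with adj? u v
    ... | yes uv = sym (reflexive (≡.cong indicator (dec-true (adj? v u) (adj-sym uv))))
    ... | no ¬uv = sym (reflexive (≡.cong indicator (dec-false (adj? v u) (¬uv ∘ adj-sym))))

    adjacency-irrefl : ∀ u → adjacency u u ≈ 0#
    adjacency-irrefl u = reflexive (≡.cong indicator (dec-false (adj? u u) (adj-irrefl ≡.refl)))

    Aα-sym : ∀ α → IsSymmetric (Aα α)
    Aα-sym α u v = +-cong (*-congˡ diagonal) (*-congˡ (adjacency-sym u v))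
      where
      diagonal : ι (degree G u) * δ u v ≈ ι (degree G v) * δ v u
      diagonal with u Fin.≟ v
      ... | yes ≡.refl = *-congˡ (sym (δ-diagonal u))
      ... | no u≢v     = trans (zeroʳ _) (sym (trans (*-congˡ (δ-off-diagonal (u≢v ∘ ≡.sym))) (zeroʳ _)))

    less : Matrix n
    less u v = indicator (does (u Fin.<? v))

    -- The matrix sees an edge in both orientations, whereas `edges` lists it once, with its smaller
    -- end first. Irreflexivity takes care of the diagonal.
    adjacency-split : ∀ u v → adjacency u v ≈ less u v * adjacency u v + less v u * adjacency u v
    adjacency-split u v with Fin.<-cmp u v
    ... | tri< u<v _ v≮u = trans (solve 1 (λ a → a := con 1ℚ :* a :+ con 0ℚ :* a) refl _) (sym (+-cong
            (*-congʳ (reflexive (≡.cong indicator (dec-true (u Fin.<? v) u<v))))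
            (*-congʳ (reflexive (≡.cong indicator (dec-false (v Fin.<? u) v≮u))))))
    ... | tri> u≮v _ v<u = trans (solve 1 (λ a → a := con 0ℚ :* a :+ con 1ℚ :* a) refl _) (sym (+-cong
            (*-congʳ (reflexive (≡.cong indicator (dec-false (u Fin.<? v) u≮v))))
            (*-congʳ (reflexive (≡.cong indicator (dec-true (v Fin.<? u) v<u))))))
    ... | tri≈ _ ≡.refl _ = trans (adjacency-irrefl u) (sym (trans
            (+-cong (trans (*-congˡ (adjacency-irrefl u)) (zeroʳ _)) (trans (*-congˡ (adjacency-irrefl u)) (zeroʳ _)))
            (+-identityˡ 0#)))

    ∑-edges : ∀ g → sumOver g (edges G) ≈ ∑ λ u → ∑ λ v → (less u v * adjacency u v) * g (u , v)
    ∑-edges g = begin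
      sumOver g (edges G)
        ≈⟨ sumOver-filter _ g (cartesianProduct (allFin n) (allFin n)) ⟩
      sumOver _ (cartesianProduct (allFin n) (allFin n))
        ≈⟨ sumOver-cartesianProduct _ (allFin n) (allFin n) ⟩
      sumOver _ (allFin n)
        ≈⟨ sumOver-tabulate _ _ ⟩
      ∑ (λ u → sumOver _ (allFin n))
        ≈⟨ ∑-cong (λ u → trans (sumOver-tabulate _ _) (∑-cong λ v →
             *-congʳ (indicator-∧ (does (u Fin.<? v)) (does (adj? u v))))) ⟩
      ∑ (λ u → ∑ λ v → (less u v * adjacency u v) * g (u , v)) ∎

    -- The common source of the handshake identity (`g` constantly 1) and of the count of the cut
    -- (`g` the indicator of pairs leading from the complement into `U`).
    ∑-adjacency : ∀ (g : Matrix n) →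
      ∑ (λ u → ∑ λ v → adjacency u v * g u v) ≈ sumOver (λ (u , v) → g u v + g v u) (edges G)
    ∑-adjacency g = begin
      ∑ (λ u → ∑ λ v → adjacency u v * g u v)
        ≈⟨ ∑-cong (λ u → trans (∑-cong λ v → trans (*-congʳ (adjacency-split u v)) (distribʳ _ _ _)) (∑-+ _ _)) ⟩
      ∑ (λ u → ∑ (λ v → (less u v * adjacency u v) * g u v) + ∑ (λ v → (less v u * adjacency u v) * g u v))
        ≈⟨ ∑-+ _ _ ⟩
      ∑ (λ u → ∑ λ v → (less u v * adjacency u v) * g u v) + ∑ (λ u → ∑ λ v → (less v u * adjacency u v) * g u v)
        ≈⟨ +-congˡ (trans (∑-swap (λ u v → (less v u * adjacency u v) * g u v))
             (∑-cong λ v → ∑-cong λ u → *-congʳ (*-congˡ (adjacency-sym u v)))) ⟩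
      ∑ (λ u → ∑ λ v → (less u v * adjacency u v) * g u v) + ∑ (λ u → ∑ λ v → (less u v * adjacency u v) * g v u)
        ≈⟨ ∑-+ _ _ ⟨
      ∑ (λ u → ∑ (λ v → (less u v * adjacency u v) * g u v) + ∑ (λ v → (less u v * adjacency u v) * g v u))
        ≈⟨ ∑-cong (λ u → trans (sym (∑-+ _ _)) (∑-cong λ v → sym (distribˡ _ _ _))) ⟩
      ∑ (λ u → ∑ λ v → (less u v * adjacency u v) * (g u v + g v u))
        ≈⟨ ∑-edges _ ⟨
      sumOver (λ (u , v) → g u v + g v u) (edges G) ∎

    ι-degree : ∀ u → ι (degree G u) ≈ ∑ (adjacency u)
    ι-degree u = trans (ι-length (filter (adj? u) (allFin n)))
      (trans (sumOver-filter (adj? u) _ (allFin n)) (trans (sumOver-tabulate _ _) (∑-cong λ v → *-identityʳ _)))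

    ι-degreeSum : ∀ U → ι (degreeSum G U) ≈ ∑ λ u → χ U u * ι (degree G u)
    ι-degreeSum U = trans (ι-sum (degree G) (filter (_∈? U) (allFin n)))
      (trans (sumOver-filter (_∈? U) _ (allFin n)) (sumOver-tabulate _ _))

    handshake : ∑ (λ u → ι (degree G u)) ≈ ι (2 ℕ.* numEdges G)
    handshake = begin
      ∑ (λ u → ι (degree G u))
        ≈⟨ ∑-cong (λ u → trans (ι-degree u) (∑-cong λ v → sym (*-identityʳ _))) ⟩
      ∑ (λ u → ∑ λ v → adjacency u v * 1#)
        ≈⟨ ∑-adjacency (λ _ _ → 1#) ⟩
      sumOver (λ _ → 1# + 1#) (edges G)
        ≈⟨ double (edges G) ⟩
      ι (numEdges G) + ι (numEdges G)
        ≈⟨ ι-double (numEdges G) ⟨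
      ι (2 ℕ.* numEdges G) ∎
      where
      double : ∀ {A : Set} (xs : List A) → sumOver (λ _ → 1# + 1#) xs ≈ ι (length xs) + ι (length xs)
      double []       = sym (trans (+-cong ι-zero ι-zero) (+-identityˡ 0#))
      double (x ∷ xs) = trans (+-congˡ (double xs)) (trans
        (solve 2 (λ o m → (o :+ o) :+ (m :+ m) := (o :+ m) :+ (o :+ m)) refl 1# _)
        (sym (+-cong (ι-suc (length xs)) (ι-suc (length xs)))))

    ∑-cut : ∀ U → ∑ (λ u → ∑ λ v → adjacency u v * (χ (∁ U) u * χ U v)) ≈ ι (length (∂ G U (∁ U)))
    ∑-cut U = begin
      ∑ (λ u → ∑ λ v → adjacency u v * (χ (∁ U) u * χ U v))
        ≈⟨ ∑-adjacency (λ u v → χ (∁ U) u * χ U v) ⟩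
      sumOver (λ (u , v) → χ (∁ U) u * χ U v + χ (∁ U) v * χ U u) (edges G)
        ≈⟨ sumOver-cong (λ (u , v) → crossing (does (u ∈? U)) (does (v ∈? U)) (∈?-∁ U u) (∈?-∁ U v)) (edges G) ⟩
      sumOver _ (edges G)
        ≈⟨ sumOver-filter _ (λ _ → 1#) (edges G) ⟨
      sumOver (λ _ → 1#) (∂ G U (∁ U))
        ≈⟨ ι-length (∂ G U (∁ U)) ⟨
      ι (length (∂ G U (∁ U))) ∎
      where
      -- Because the second set is the complement of the first, an edge cannot satisfy both
      -- alternatives in `∂`, and the disjunction turns into a sum.
      crossing : ∀ x y {x′ y′} → x′ ≡ not x → y′ ≡ not y →
        indicator x′ * indicator y + indicator y′ * indicator x ≈ indicator ((x ∧ y′) ∨ (y ∧ x′)) * 1#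
      crossing true  true  ≡.refl ≡.refl = solve 0 (con 0ℚ :* con 1ℚ :+ con 0ℚ :* con 1ℚ := con 0ℚ :* con 1ℚ) refl
      crossing true  false ≡.refl ≡.refl = solve 0 (con 0ℚ :* con 0ℚ :+ con 1ℚ :* con 1ℚ := con 1ℚ :* con 1ℚ) refl
      crossing false true  ≡.refl ≡.refl = solve 0 (con 1ℚ :* con 1ℚ :+ con 0ℚ :* con 0ℚ := con 1ℚ :* con 1ℚ) refl
      crossing false false ≡.refl ≡.refl = solve 0 (con 1ℚ :* con 0ℚ :+ con 1ℚ :* con 0ℚ := con 0ℚ :* con 1ℚ) refl

  -- The orthogonal projection onto the span of the unit vectors e_u (u ∈ U) and the indicator vector
  -- of the complement of U, where ω is the reciprocal of the size of that complement.
  module Projection {n : ℕ} (U : Subset n) (ω : Carrier) (ω-inverse : ω * ι ∣ ∁ U ∣ ≈ 1#) where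

    ψ : Vector n
    ψ = χ (∁ U)

    Q : Matrix n
    Q a b = χ U a * δ a b + ω * (ψ a * ψ b)

    Q-sym : IsSymmetric Q
    Q-sym a b = +-cong diagonal (*-congˡ (*-comm _ _))
      where
      diagonal : χ U a * δ a b ≈ χ U b * δ b a
      diagonal with a Fin.≟ b
      ... | yes ≡.refl = *-congˡ (sym (δ-diagonal a))
      ... | no a≢b     = trans (zeroʳ _) (sym (trans (*-congˡ (δ-off-diagonal (a≢b ∘ ≡.sym))) (zeroʳ _)))

    ∑-Q* : ∀ a (f : Vector n) → ∑ (λ b → Q a b * f b) ≈ χ U a * f a + (ω * ψ a) * ∑ (λ b → ψ b * f b)
    ∑-Q* a f = begin
      ∑ (λ b → Q a b * f b)
        ≈⟨ ∑-cong (λ b → solve 6 (λ x d o p q f → (x :* d :+ o :* (p :* q)) :* f := x :* (d :* f) :+ (o :* p) :* (q :* f))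
             refl (χ U a) (δ a b) ω (ψ a) (ψ b) (f b)) ⟩
      ∑ (λ b → χ U a * (δ a b * f b) + (ω * ψ a) * (ψ b * f b))
        ≈⟨ ∑-linear (χ U a) (ω * ψ a) _ _ ⟩
      χ U a * ∑ (λ b → δ a b * f b) + (ω * ψ a) * ∑ (λ b → ψ b * f b)
        ≈⟨ +-congʳ (*-congˡ (∑-δ* a f)) ⟩
      χ U a * f a + (ω * ψ a) * ∑ (λ b → ψ b * f b) ∎

    -- The two summands of `Q` annihilate each other, as `χ U` and `ψ` have disjoint supports. Each
    -- is idempotent: the first since `χ U` takes the values 0 and 1, the second since `ω` is the
    -- reciprocal of the squared norm of `ψ`.
    Q-idem : ∀ a c → ∑ (λ b → Q a b * Q b c) ≈ Q a c
    Q-idem a c = begin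
      ∑ (λ b → Q a b * Q b c)
        ≈⟨ ∑-Q* a (λ b → Q b c) ⟩
      χ U a * Q a c + (ω * ψ a) * ∑ (λ b → ψ b * Q b c)
        ≈⟨ +-cong
             (trans (solve 5 (λ x d o p q → x :* (x :* d :+ o :* (p :* q)) := (x :* x) :* d :+ o :* ((x :* p) :* q))
                       refl (χ U a) (δ a c) ω (ψ a) (ψ c))
                    (+-cong (*-congʳ (χ-idem U a)) (trans (*-congˡ (trans (*-congʳ (χ*χ-∁ U a)) (zeroˡ _))) (zeroʳ _))))
             (*-congˡ ψQ) ⟩
      (χ U a * δ a c + 0#) + (ω * ψ a) * ψ c
        ≈⟨ +-cong (+-identityʳ _) (*-assoc _ _ _) ⟩
      Q a c ∎
      where
      ψQ : ∑ (λ b → ψ b * Q b c) ≈ ψ c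
      ψQ = begin
        ∑ (λ b → ψ b * Q b c)
          ≈⟨ ∑-cong (λ b → trans
               (solve 5 (λ x d o p q → p :* (x :* d :+ o :* (p :* q)) := (x :* p) :* d :+ (o :* q) :* (p :* p))
                 refl (χ U b) (δ b c) ω (ψ b) (ψ c))
               (trans (+-cong (trans (*-congʳ (χ*χ-∁ U b)) (zeroˡ _)) (*-congˡ (χ-idem (∁ U) b))) (+-identityˡ _))) ⟩
        ∑ (λ b → (ω * ψ c) * ψ b)
          ≈⟨ *-∑ (ω * ψ c) ψ ⟨
        (ω * ψ c) * ∑ ψ
          ≈⟨ *-congˡ (∑-χ (∁ U)) ⟩
        (ω * ψ c) * ι ∣ ∁ U ∣
          ≈⟨ solve 3 (λ o p w → (o :* p) :* w := (o :* w) :* p) refl ω (ψ c) _ ⟩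
        (ω * ι ∣ ∁ U ∣) * ψ c
          ≈⟨ trans (*-congʳ ω-inverse) (*-identityˡ _) ⟩
        ψ c ∎

    trace-Q : ∑ (λ a → Q a a) ≈ ∑ {suc ∣ U ∣} λ _ → 1#
    trace-Q = begin
      ∑ (λ a → χ U a * δ a a + ω * (ψ a * ψ a))
        ≈⟨ ∑-cong (λ a → +-cong (trans (*-congˡ (δ-diagonal a)) (*-comm _ _)) (*-congˡ (χ-idem (∁ U) a))) ⟩
      ∑ (λ a → 1# * χ U a + ω * ψ a)
        ≈⟨ ∑-linear 1# ω _ _ ⟩
      1# * ∑ (χ U) + ω * ∑ ψ
        ≈⟨ +-cong (trans (*-identityˡ _) (∑-χ U)) (trans (*-congˡ (∑-χ (∁ U))) ω-inverse) ⟩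
      ι ∣ U ∣ + 1#
        ≈⟨ trans (+-comm _ _) (sym (ι-suc _)) ⟩
      ι (suc ∣ U ∣)
        ≈⟨ ∑-const-1 (suc ∣ U ∣) ⟨
      ∑ {suc ∣ U ∣} (λ _ → 1#) ∎

    -- The trace of the projected matrix

    module _ (G : Graph n) where
      open Counting G

      -- The part on `U` meets only the diagonal, which is α d. On the complement the adjacency
      -- entries add up to the outside degrees minus the cut, so α and 1 - α recombine to give each
      -- outside degree coefficient 1 and the cut coefficient -(1 - α). By the handshake identity
      -- the outside degrees add up to 2m - D.
      compression : ∀ α → ∑ (λ a → ∑ λ b → Q a b * Aα α b a) ≈
        (α - ω) * ι (degreeSum G U) + (ι (2 ℕ.* numEdges G) - (1# - α) * ι (length (∂ G U (∁ U)))) * ω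
      compression α = begin
        ∑ (λ a → ∑ λ b → Q a b * Aα α b a)
          ≈⟨ ∑-cong (λ a → trans (∑-Q* a (λ b → Aα α b a)) (+-cong (diagonal a) (*-congˡ (column a)))) ⟩
        ∑ (λ a → α * (χ U a * d a) + (ω * ψ a) * (α * (ψ a * d a) + (1# - α) * (d a - cut a)))
          ≈⟨ ∑-cong (λ a → trans
               (solve 7 (λ x d o p q a k → a :* (x :* d) :+ (o :* p) :* (a :* (p :* d) :+ q :* (d :- k)) :=
                  a :* (x :* d) :+ (o :* a) :* ((p :* p) :* d) :+ (o :* q) :* (p :* d) :- (o :* q) :* (p :* k))
                  refl (χ U a) (d a) ω (ψ a) (1# - α) α (cut a))
               (trans (+-congʳ (+-congʳ (+-congˡ (*-congˡ (*-congʳ (χ-idem (∁ U) a))))))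
               (solve 7 (λ x d o p q a k → a :* (x :* d) :+ (o :* a) :* (p :* d) :+ (o :* q) :* (p :* d) :- (o :* q) :* (p :* k) :=
                  con 1ℚ :* (a :* (x :* d) :+ (o :* (a :+ q)) :* (p :* d)) :+ (:- (o :* q)) :* (p :* k))
                  refl (χ U a) (d a) ω (ψ a) (1# - α) α (cut a)))) ⟩
        ∑ (λ a → 1# * (α * (χ U a * d a) + (ω * (α + (1# - α))) * (ψ a * d a)) + (- (ω * (1# - α))) * (ψ a * cut a))
          ≈⟨ trans (∑-linear 1# (- (ω * (1# - α))) _ _) (+-congʳ (*-congˡ (∑-linear α (ω * (α + (1# - α))) _ _))) ⟩
        1# * (α * ∑ (λ a → χ U a * d a) + (ω * (α + (1# - α))) * ∑ (λ a → ψ a * d a)) + (- (ω * (1# - α))) * ∑ (λ a → ψ a * cut a)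
          ≈⟨ +-cong (*-congˡ (+-cong (*-congˡ (sym (ι-degreeSum U))) (*-congˡ outside))) (*-congˡ total-cut) ⟩
        1# * (α * D + (ω * (α + (1# - α))) * (m₂ - D)) + (- (ω * (1# - α))) * b
          ≈⟨ solve 5 (λ a o D m b → con 1ℚ :* (a :* D :+ (o :* (a :+ (con 1ℚ :- a))) :* (m :- D)) :+ (:- (o :* (con 1ℚ :- a))) :* b :=
               (a :- o) :* D :+ (m :- (con 1ℚ :- a) :* b) :* o) refl α ω D m₂ b ⟩
        (α - ω) * D + (m₂ - (1# - α) * b) * ω ∎
        where
        d : Vector n
        d a = ι (degree G a)

        cut : Vector n
        cut a = ∑ λ b → adjacency a b * χ U b

        D m₂ b : Carrier
        D  = ι (degreeSum G U)
        m₂ = ι (2 ℕ.* numEdges G)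
        b  = ι (length (∂ G U (∁ U)))

        diagonal : ∀ a → χ U a * Aα α a a ≈ α * (χ U a * d a)
        diagonal a = trans (*-congˡ (+-cong (*-congˡ (trans (*-congˡ (δ-diagonal a)) (*-identityʳ _))) (trans (*-congˡ (adjacency-irrefl a)) (zeroʳ _))))
          (solve 3 (λ x a d → x :* (a :* d :+ con 0ℚ) := a :* (x :* d)) refl (χ U a) α (d a))

        column : ∀ a → ∑ (λ b → ψ b * Aα α b a) ≈ α * (ψ a * d a) + (1# - α) * (d a - cut a)
        column a = begin
          ∑ (λ b → ψ b * Aα α b a)
            ≈⟨ ∑-cong (λ b → trans (*-congˡ (+-congˡ (*-congˡ (adjacency-sym b a))))
                 (solve 6 (λ p a d e q A → p :* (a :* (d :* e) :+ q :* A) := a :* ((p :* d) :* e) :+ q :* (p :* A)) refl (ψ b) α (d b) (δ b a) (1# - α) (adjacency a b))) ⟩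
          ∑ (λ b → α * ((ψ b * d b) * δ b a) + (1# - α) * (ψ b * adjacency a b))
            ≈⟨ ∑-linear α (1# - α) _ _ ⟩
          α * ∑ (λ b → (ψ b * d b) * δ b a) + (1# - α) * ∑ (λ b → ψ b * adjacency a b)
            ≈⟨ +-cong (*-congˡ (∑-*δ (λ b → ψ b * d b) a)) (*-congˡ (begin
                 ∑ (λ b → ψ b * adjacency a b)
                   ≈⟨ ∑-cong (λ b → trans (*-congʳ (χ-∁ U b))
                        (solve 2 (λ x A → (con 1ℚ :- x) :* A := con 1ℚ :* A :+ (:- con 1ℚ) :* (A :* x)) refl (χ U b) (adjacency a b))) ⟩
                 ∑ (λ b → 1# * adjacency a b + (- 1#) * (adjacency a b * χ U b))
                   ≈⟨ ∑-linear 1# (- 1#) _ _ ⟩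
                 1# * ∑ (adjacency a) + (- 1#) * cut a
                   ≈⟨ +-congʳ (*-congˡ (sym (ι-degree a))) ⟩
                 1# * d a + (- 1#) * cut a
                   ≈⟨ solve 2 (λ d k → con 1ℚ :* d :+ (:- con 1ℚ) :* k := d :- k) refl (d a) (cut a) ⟩
                 d a - cut a ∎)) ⟩
          α * (ψ a * d a) + (1# - α) * (d a - cut a) ∎

        outside : ∑ (λ a → ψ a * d a) ≈ m₂ - D
        outside = begin
          ∑ (λ a → ψ a * d a)
            ≈⟨ ∑-cong (λ a → trans (*-congʳ (χ-∁ U a))
                 (solve 2 (λ x d → (con 1ℚ :- x) :* d := con 1ℚ :* d :+ (:- con 1ℚ) :* (x :* d)) refl (χ U a) (d a))) ⟩
          ∑ (λ a → 1# * d a + (- 1#) * (χ U a * d a))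
            ≈⟨ ∑-linear 1# (- 1#) _ _ ⟩
          1# * ∑ d + (- 1#) * ∑ (λ a → χ U a * d a)
            ≈⟨ +-cong (*-congˡ handshake) (*-congˡ (sym (ι-degreeSum U))) ⟩
          1# * m₂ + (- 1#) * D
            ≈⟨ solve 2 (λ m D → con 1ℚ :* m :+ (:- con 1ℚ) :* D := m :- D) refl m₂ D ⟩
          m₂ - D ∎

        total-cut : ∑ (λ a → ψ a * cut a) ≈ b
        total-cut = trans (∑-cong λ a → trans (*-∑ (ψ a) _) (∑-cong λ b →
          solve 3 (λ p A x → p :* (A :* x) := A :* (p :* x)) refl (ψ a) (adjacency a b) (χ U b))) (∑-cut U)

  reciprocal : ∀ m → ⟦ + 1 ℚ./ suc m ⟧ * ι (suc m) ≈ 1#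
  reciprocal m = begin
    ⟦ + 1 ℚ./ suc m ⟧ * ι (suc m)                  ≈⟨ *-congˡ (ι≈⟦⟧ (suc m)) ⟩
    ⟦ + 1 ℚ./ suc m ⟧ * ⟦ + suc m ℚ./ 1 ⟧          ≈⟨ *-homo (+ 1 ℚ./ suc m) (+ suc m ℚ./ 1) ⟨
    ⟦ (+ 1 ℚ./ suc m) ℚ.* (+ suc m ℚ./ 1) ⟧        ≡⟨ ≡.cong ⟦_⟧ (1/n*n/1 m) ⟩
    ⟦ 1ℚ ⟧                                       ≈⟨ 1-homo ⟩
    1#                                             ∎

  charPoly-cong : ∀ {n} (M N : Matrix n) → (∀ u v → M u v ≈ N u v) → ∀ t → charPoly M t ≈ charPoly N t
  charPoly-cong M N M≈N t = det-cong λ u v → +-congˡ (-‿cong (M≈N u v))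

  -- Here `k` is the size of `U`, one less than the index in the theorem. The constants are embedded
  -- rationals, which for the reals become `fromℕ` and `1/ℕ`.
  eigenvalue-sum-bound : ∀ {n} (G : Graph n) α k (k<n : k ℕ.< n) (U : Subset n) → ∣ U ∣ ≡ k →
    (μ : Vector n) → (∀ i j → i Fin.≤ j → μ j ≤ μ i) →
    (∀ t → charPoly (λ u v → α * (⟦ + degree G u ℚ./ 1 ⟧ * δ u v) + (1# - α) * Counting.adjacency G u v) t
             ≈ product (λ j → t - μ j)) →
    (α - ⟦ + 1 ℚ./ suc (n ℕ.∸ suc k) ⟧) * ⟦ + degreeSum G U ℚ./ 1 ⟧
      + (⟦ + (2 ℕ.* numEdges G) ℚ./ 1 ⟧ - (1# - α) * ⟦ + length (∂ G U (∁ U)) ℚ./ 1 ⟧) * ⟦ + 1 ℚ./ suc (n ℕ.∸ suc k) ⟧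
    ≤ ∑ (λ i → μ (inject≤ i k<n))
  eigenvalue-sum-bound {n} G α k k<n U ≡.refl μ descending χ≈ = ≤.trans
    (≤.reflexive (trans
      (+-cong (*-congˡ (sym (ι≈⟦⟧ _))) (*-congʳ (+-cong (sym (ι≈⟦⟧ _)) (-‿cong (*-congˡ (sym (ι≈⟦⟧ _)))))))
      (sym (compression G α))))
    (kyFan (Counting.Aα G α) (Counting.Aα-sym G α) μ descending
      (λ t → trans (charPoly-cong (Counting.Aα G α) _ (λ u v → +-congʳ (*-congˡ (*-congʳ (ι≈⟦⟧ _)))) t) (χ≈ t))
      Q Q-sym Q-idem k k<n trace-Q)
    where
    -- From `k < n` the complement has `n ∸ k ≡ suc (n ∸ suc k)` elements, a successor and hence
    -- invertible.
    open Projection U ⟦ + 1 ℚ./ suc (n ℕ.∸ suc k) ⟧ (trans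
      (*-congˡ (reflexive (≡.cong ι (≡.trans (∣∁p∣≡n∸∣p∣ U) (ℕ.+-∸-assoc 1 k<n)))))
      (reciprocal (n ℕ.∸ suc k)))

open import Defs

-- The ordered field of Cauchy reals

module ℚ-Solver = +-*-Solver
open ℚ-Solver using (_:=_; _:+_; _:*_; _:-_; :-_)
open ℚ.≤-Reasoning

p≤∣p∣ : ∀ p → p ℚ.≤ ℚ.∣ p ∣
p≤∣p∣ p with ℚ.≤-total 0ℚ p
... | inj₁ 0≤p = ℚ.≤-reflexive (≡.sym (ℚ.0≤p⇒∣p∣≡p 0≤p))
... | inj₂ p≤0 = ℚ.≤-trans p≤0 (ℚ.0≤∣p∣ p)

∣p∣≤q : ∀ {p q} → p ℚ.≤ q → ℚ.- p ℚ.≤ q → ℚ.∣ p ∣ ℚ.≤ q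
∣p∣≤q {p} p≤q -p≤q with ℚ.∣p∣≡p∨∣p∣≡-p p
... | inj₁ eq = ℚ.≤-trans (ℚ.≤-reflexive eq) p≤q
... | inj₂ eq = ℚ.≤-trans (ℚ.≤-reflexive eq) -p≤q

p-q≤r⇒p≤q+r : ∀ p q r → p ℚ.- q ℚ.≤ r → p ℚ.≤ q ℚ.+ r
p-q≤r⇒p≤q+r p q r h = begin
  p                    ≡⟨ ℚ-Solver.solve 2 (λ p q → p := q :+ (p :- q)) ≡.refl p q ⟩
  q ℚ.+ (p ℚ.- q)      ≤⟨ ℚ.+-monoʳ-≤ q h ⟩
  q ℚ.+ r              ∎

p≤q+r⇒p-q≤r : ∀ p q r → p ℚ.≤ q ℚ.+ r → p ℚ.- q ℚ.≤ r
p≤q+r⇒p-q≤r p q r h = begin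
  p ℚ.- q              ≤⟨ ℚ.+-monoˡ-≤ (ℚ.- q) h ⟩
  q ℚ.+ r ℚ.- q        ≡⟨ ℚ-Solver.solve 2 (λ q r → q :+ r :- q := r) ≡.refl q r ⟩
  r                    ∎

fraction : ∀ {b ε} → 0ℚ ℚ.< b → 0ℚ ℚ.< ε → ∃ λ d → 0ℚ ℚ.< d × b ℚ.* d ≡ ε
fraction {b} {ε} 0<b 0<ε = 1/b ℚ.* ε
  , ≡.subst (ℚ._< 1/b ℚ.* ε) (ℚ.*-zeroʳ 1/b) (ℚ.*-monoʳ-<-pos 1/b {{ℚ.1/pos⇒pos b}} 0<ε)
  , ≡.trans (≡.sym (ℚ.*-assoc b 1/b ε)) (≡.trans (≡.cong (ℚ._* ε) (ℚ.*-inverseʳ b)) (ℚ.*-identityˡ ε))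
  where
  instance
    b-pos : ℚ.Positive b
    b-pos = ℚ.positive 0<b
    b≢0 : ℚ.NonZero b
    b≢0 = ℚ.pos⇒nonZero b
  1/b : ℚ
  1/b = ℚ.1/ b

-- Order and congruence for Cauchy sequences

≤-refl : ∀ x → x ≤ x
≤-refl x ε 0<ε = 0 , λ n _ → ≡.subst (ℚ._≤ seq x n ℚ.+ ε) (ℚ.+-identityʳ (seq x n)) (ℚ.+-monoʳ-≤ (seq x n) (ℚ.<⇒≤ 0<ε))

≤-trans : ∀ x y z → x ≤ y → y ≤ z → x ≤ z
≤-trans x y z x≤y y≤z ε 0<ε =
  let M , p = x≤y (ℚ.½ ℚ.* ε) (½-pos 0<ε)
      N , q = y≤z (ℚ.½ ℚ.* ε) (½-pos 0<ε)
  in M ℕ.⊔ N , λ n b → begin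
    seq x n                                        ≤⟨ p n (ℕ.m⊔n≤o⇒m≤o M N b) ⟩
    seq y n ℚ.+ ℚ.½ ℚ.* ε                          ≤⟨ ℚ.+-monoˡ-≤ (ℚ.½ ℚ.* ε) (q n (ℕ.m⊔n≤o⇒n≤o M N b)) ⟩
    seq z n ℚ.+ ℚ.½ ℚ.* ε ℚ.+ ℚ.½ ℚ.* ε            ≡⟨ ℚ.+-assoc (seq z n) _ _ ⟩
    seq z n ℚ.+ (ℚ.½ ℚ.* ε ℚ.+ ℚ.½ ℚ.* ε)          ≡⟨ ≡.cong (seq z n ℚ.+_) (½+½ ε) ⟩
    seq z n ℚ.+ ε                                  ∎

≤-antisym : ∀ x y → x ≤ y → y ≤ x → x ≈ y
≤-antisym x y x≤y y≤x ε 0<ε =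
  let M , p = x≤y ε 0<ε
      N , q = y≤x ε 0<ε
  in M ℕ.⊔ N , λ n b → ∣p∣≤q
    (p≤q+r⇒p-q≤r (seq x n) (seq y n) ε (p n (ℕ.m⊔n≤o⇒m≤o M N b)))
    (ℚ.≤-trans (ℚ.≤-reflexive (ℚ-Solver.solve 2 (λ a b → :- (a :- b) := b :- a) ≡.refl (seq x n) (seq y n)))
      (p≤q+r⇒p-q≤r (seq y n) (seq x n) ε (q n (ℕ.m⊔n≤o⇒n≤o M N b))))

≈⇒≤ : ∀ x y → x ≈ y → x ≤ y
≈⇒≤ x y x≈y ε 0<ε = let N , p = x≈y ε 0<ε in N , λ n b →
  p-q≤r⇒p≤q+r (seq x n) (seq y n) ε (ℚ.≤-trans (p≤∣p∣ _) (p n b))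

≈-sym : ∀ x y → x ≈ y → y ≈ x
≈-sym x y x≈y ε 0<ε = let N , p = x≈y ε 0<ε in N , λ n b → ℚ.≤-trans (ℚ.≤-reflexive
  (≡.trans (≡.cong ℚ.∣_∣ (ℚ-Solver.solve 2 (λ a b → b :- a := :- (a :- b)) ≡.refl (seq x n) (seq y n))) (ℚ.∣-p∣≡∣p∣ _))) (p n b)

≈-trans : ∀ x y z → x ≈ y → y ≈ z → x ≈ z
≈-trans x y z x≈y y≈z = ≤-antisym x z
  (≤-trans x y z (≈⇒≤ x y x≈y) (≈⇒≤ y z y≈z))
  (≤-trans z y x (≈⇒≤ z y (≈-sym y z y≈z)) (≈⇒≤ y x (≈-sym x y x≈y)))

≗⇒≈ : ∀ x y → (∀ n → seq x n ≡ seq y n) → x ≈ y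
≗⇒≈ x y h ε 0<ε = 0 , λ n _ → ≡.subst (λ q → ℚ.∣ q ∣ ℚ.≤ ε)
  (≡.sym (≡.trans (≡.cong (ℚ._- seq y n) (h n)) (ℚ.+-inverseʳ (seq y n)))) (ℚ.<⇒≤ 0<ε)

+-mono-≤ : ∀ x y z w → x ≤ y → z ≤ w → x + z ≤ y + w
+-mono-≤ x y z w x≤y z≤w ε 0<ε =
  let M , p = x≤y (ℚ.½ ℚ.* ε) (½-pos 0<ε)
      N , q = z≤w (ℚ.½ ℚ.* ε) (½-pos 0<ε)
  in M ℕ.⊔ N , λ n b → begin
    seq x n ℚ.+ seq z n
      ≤⟨ ℚ.+-mono-≤ (p n (ℕ.m⊔n≤o⇒m≤o M N b)) (q n (ℕ.m⊔n≤o⇒n≤o M N b)) ⟩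
    (seq y n ℚ.+ ℚ.½ ℚ.* ε) ℚ.+ (seq w n ℚ.+ ℚ.½ ℚ.* ε)
      ≡⟨ ℚ-Solver.solve 3 (λ y w e → (y :+ e) :+ (w :+ e) := (y :+ w) :+ (e :+ e)) ≡.refl (seq y n) (seq w n) (ℚ.½ ℚ.* ε) ⟩
    (seq y n ℚ.+ seq w n) ℚ.+ (ℚ.½ ℚ.* ε ℚ.+ ℚ.½ ℚ.* ε)
      ≡⟨ ≡.cong (seq y n ℚ.+ seq w n ℚ.+_) (½+½ ε) ⟩
    seq y n ℚ.+ seq w n ℚ.+ ε ∎

+-cong : ∀ x y z w → x ≈ y → z ≈ w → x + z ≈ y + w
+-cong x y z w x≈y z≈w = ≤-antisym (x + z) (y + w)
  (+-mono-≤ x y z w (≈⇒≤ x y x≈y) (≈⇒≤ z w z≈w))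
  (+-mono-≤ y x w z (≈⇒≤ y x (≈-sym x y x≈y)) (≈⇒≤ w z (≈-sym z w z≈w)))

-‿cong : ∀ x y → x ≈ y → - x ≈ - y
-‿cong x y x≈y ε 0<ε = let N , p = x≈y ε 0<ε in N , λ n b → ℚ.≤-trans (ℚ.≤-reflexive
  (≡.trans (≡.cong ℚ.∣_∣ (ℚ-Solver.solve 2 (λ a b → :- a :- (:- b) := :- (a :- b)) ≡.refl (seq x n) (seq y n))) (ℚ.∣-p∣≡∣p∣ _))) (p n b)

*-congʳ : ∀ x y z → x ≈ y → x * z ≈ y * z
*-congʳ x y z x≈y ε 0<ε =
  let B , 0<B , K , bounded = eventuallyBounded (seq z) (cauchy z)
      d , 0<d , Bd≡ε        = fraction 0<B 0<ε
      N , close             = x≈y d 0<d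
  in K ℕ.⊔ N , λ n b → begin
    ℚ.∣ seq x n ℚ.* seq z n ℚ.- seq y n ℚ.* seq z n ∣
      ≡⟨ ≡.cong ℚ.∣_∣ (ℚ-Solver.solve 3 (λ x y z → x :* z :- y :* z := z :* (x :- y)) ≡.refl (seq x n) (seq y n) (seq z n)) ⟩
    ℚ.∣ seq z n ℚ.* (seq x n ℚ.- seq y n) ∣
      ≡⟨ ℚ.∣p*q∣≡∣p∣*∣q∣ (seq z n) _ ⟩
    ℚ.∣ seq z n ∣ ℚ.* ℚ.∣ seq x n ℚ.- seq y n ∣
      ≤⟨ *-mono-≤-nonNeg ℚ.∣ seq z n ∣ B ℚ.∣ seq x n ℚ.- seq y n ∣ d (ℚ.0≤∣p∣ _) (ℚ.<⇒≤ 0<B)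
           (bounded n (ℕ.m⊔n≤o⇒m≤o K N b)) (close n (ℕ.m⊔n≤o⇒n≤o K N b)) ⟩
    B ℚ.* d
      ≡⟨ Bd≡ε ⟩
    ε ∎

*-comm : ∀ x y → x * y ≈ y * x
*-comm x y = ≗⇒≈ (x * y) (y * x) λ n → ℚ.*-comm (seq x n) (seq y n)

*-cong : ∀ x y z w → x ≈ y → z ≈ w → x * z ≈ y * w
*-cong x y z w x≈y z≈w = ≈-trans (x * z) (y * z) (y * w) (*-congʳ x y z x≈y)
  (≈-trans (y * z) (z * y) (y * w) (*-comm y z)
    (≈-trans (z * y) (w * y) (y * w) (*-congʳ z w y z≈w) (*-comm w y)))

ℝ-commutativeRing : CommutativeRing _ _
ℝ-commutativeRing = record
  { Carrier = ℝ ; _≈_ = _≈_ ; _+_ = _+_ ; _*_ = _*_ ; -_ = -_ ; 0# = 0ℝ ; 1# = 1ℝ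
  ; isCommutativeRing = record
    { isRing = record
      { +-isAbelianGroup = record
        { isGroup = record
          { isMonoid = record
            { isSemigroup = record
              { isMagma = record
                { isEquivalence = record
                  { refl  = λ {x} → ≗⇒≈ x x λ _ → ≡.refl
                  ; sym   = λ {x y} → ≈-sym x y
                  ; trans = λ {x y z} → ≈-trans x y z
                  }
                ; ∙-cong = λ {x y z w} → +-cong x y z w
                }
              ; assoc = λ x y z → ≗⇒≈ (x + y + z) (x + (y + z)) λ n → ℚ.+-assoc (seq x n) (seq y n) (seq z n)
              }
            ; identity = (λ x → ≗⇒≈ (0ℝ + x) x λ n → ℚ.+-identityˡ (seq x n))
                       , (λ x → ≗⇒≈ (x + 0ℝ) x λ n → ℚ.+-identityʳ (seq x n))
            }
          ; inverse = (λ x → ≗⇒≈ (- x + x) 0ℝ λ n → ℚ.+-inverseˡ (seq x n))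
                    , (λ x → ≗⇒≈ (x + - x) 0ℝ λ n → ℚ.+-inverseʳ (seq x n))
          ; ⁻¹-cong = λ {x y} → -‿cong x y
          }
        ; comm = λ x y → ≗⇒≈ (x + y) (y + x) λ n → ℚ.+-comm (seq x n) (seq y n)
        }
      ; *-cong = λ {x y z w} → *-cong x y z w
      ; *-assoc = λ x y z → ≗⇒≈ (x * y * z) (x * (y * z)) λ n → ℚ.*-assoc (seq x n) (seq y n) (seq z n)
      ; *-identity = (λ x → ≗⇒≈ (1ℝ * x) x λ n → ℚ.*-identityˡ (seq x n))
                   , (λ x → ≗⇒≈ (x * 1ℝ) x λ n → ℚ.*-identityʳ (seq x n))
      ; distrib = (λ x y z → ≗⇒≈ (x * (y + z)) (x * y + x * z) λ n → ℚ.*-distribˡ-+ (seq x n) (seq y n) (seq z n))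
                , (λ x y z → ≗⇒≈ ((y + z) * x) (y * x + z * x) λ n → ℚ.*-distribʳ-+ (seq x n) (seq y n) (seq z n))
      }
    ; *-comm = *-comm
    }
  }

-- Negated strict order, trichotomy and reciprocals

p<q⇒0<q-p : ∀ {p q} → p ℚ.< q → 0ℚ ℚ.< q ℚ.- p
p<q⇒0<q-p {p} {q} p<q = ≡.subst (ℚ._< q ℚ.- p) (ℚ.+-inverseʳ p) (ℚ.+-monoˡ-< (ℚ.- p) p<q)

-- The comparison is made at a single index `K`, between rationals, where it is decidable. Beyond
-- `K` each sequence moves by at most `e`; if `seq y K` exceeded `seq x K` by more than 2e, the
-- excess would be a lasting gap witnessing `x < y`. The 2e and one drift of each sequence make up ε
-- = 4e.
≮⇒≥ : ∀ x y → ¬ (x < y) → y ≤ x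
≮⇒≥ x y x≮y ε 0<ε = K , λ n b → begin
    seq y n
      ≡⟨ ℚ-Solver.solve 2 (λ a b → a := (a :- b) :+ b) ≡.refl (seq y n) (seq y K) ⟩
    (seq y n ℚ.- seq y K) ℚ.+ seq y K
      ≤⟨ ℚ.+-mono-≤ (y-yK n b) yK≤ ⟩
    e ℚ.+ (seq x K ℚ.+ (e ℚ.+ e))
      ≡⟨ ℚ-Solver.solve 3 (λ e a b → e :+ (a :+ (e :+ e)) := (a :- b) :+ (b :+ (e :+ e :+ e))) ≡.refl e (seq x K) (seq x n) ⟩
    (seq x K ℚ.- seq x n) ℚ.+ (seq x n ℚ.+ (e ℚ.+ e ℚ.+ e))
      ≤⟨ ℚ.+-monoˡ-≤ _ (xK-x n b) ⟩
    e ℚ.+ (seq x n ℚ.+ (e ℚ.+ e ℚ.+ e))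
      ≡⟨ ℚ-Solver.solve 2 (λ e a → e :+ (a :+ (e :+ e :+ e)) := a :+ ((e :+ e) :+ (e :+ e))) ≡.refl e (seq x n) ⟩
    seq x n ℚ.+ ((e ℚ.+ e) ℚ.+ (e ℚ.+ e))
      ≡⟨ ≡.cong (seq x n ℚ.+_) 4e≡ε ⟩
    seq x n ℚ.+ ε ∎
  where
  e : ℚ
  e = ℚ.½ ℚ.* (ℚ.½ ℚ.* ε)

  0<e : 0ℚ ℚ.< e
  0<e = ½-pos (½-pos 0<ε)

  4e≡ε : (e ℚ.+ e) ℚ.+ (e ℚ.+ e) ≡ ε
  4e≡ε = ≡.trans (≡.cong₂ ℚ._+_ (½+½ (ℚ.½ ℚ.* ε)) (½+½ (ℚ.½ ℚ.* ε))) (½+½ ε)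

  M N K : ℕ
  M = proj₁ (cauchy x e 0<e)
  N = proj₁ (cauchy y e 0<e)
  K = M ℕ.⊔ N

  x-close : ∀ m n → K ℕ.≤ m → K ℕ.≤ n → seq x m ℚ.- seq x n ℚ.≤ e
  x-close m n a b = ℚ.≤-trans (p≤∣p∣ _) (proj₂ (cauchy x e 0<e) m n (ℕ.m⊔n≤o⇒m≤o M N a) (ℕ.m⊔n≤o⇒m≤o M N b))

  y-close : ∀ m n → K ℕ.≤ m → K ℕ.≤ n → seq y m ℚ.- seq y n ℚ.≤ e
  y-close m n a b = ℚ.≤-trans (p≤∣p∣ _) (proj₂ (cauchy y e 0<e) m n (ℕ.m⊔n≤o⇒n≤o M N a) (ℕ.m⊔n≤o⇒n≤o M N b))

  xK-x : ∀ n → K ℕ.≤ n → seq x K ℚ.- seq x n ℚ.≤ e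
  xK-x n = x-close K n ℕ.≤-refl

  y-yK : ∀ n → K ℕ.≤ n → seq y n ℚ.- seq y K ℚ.≤ e
  y-yK n b = y-close n K b ℕ.≤-refl

  yK≤ : seq y K ℚ.≤ seq x K ℚ.+ (e ℚ.+ e)
  yK≤ = ℚ.≮⇒≥ λ lt → x≮y (seq y K ℚ.- (seq x K ℚ.+ (e ℚ.+ e)) , p<q⇒0<q-p lt , K , λ n b → begin
    seq x n ℚ.+ (seq y K ℚ.- (seq x K ℚ.+ (e ℚ.+ e)))
      ≡⟨ ℚ-Solver.solve 5 (λ a b c d e → a :+ (b :- (c :+ (e :+ e))) := (a :- c) :+ ((b :- d) :+ (d :- (e :+ e))))
           ≡.refl (seq x n) (seq y K) (seq x K) (seq y n) e ⟩
    (seq x n ℚ.- seq x K) ℚ.+ ((seq y K ℚ.- seq y n) ℚ.+ (seq y n ℚ.- (e ℚ.+ e)))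
      ≤⟨ ℚ.+-mono-≤ (x-close n K b ℕ.≤-refl) (ℚ.+-monoˡ-≤ _ (y-close K n ℕ.≤-refl b)) ⟩
    e ℚ.+ (e ℚ.+ (seq y n ℚ.- (e ℚ.+ e)))
      ≡⟨ ℚ-Solver.solve 2 (λ d e → e :+ (e :+ (d :- (e :+ e))) := d) ≡.refl (seq y n) e ⟩
    seq y n ∎)

<⇒≱ : ∀ x y → x < y → ¬ (y ≤ x)
<⇒≱ x y (ε , 0<ε , M , p) y≤x =
  let N , q = y≤x (ℚ.½ ℚ.* ε) (½-pos 0<ε)
      n     = M ℕ.⊔ N
  in ℚ.<-irrefl ≡.refl (begin-strict
    seq x n ℚ.+ ℚ.½ ℚ.* ε                      ≡⟨ ℚ.+-identityʳ _ ⟨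
    seq x n ℚ.+ ℚ.½ ℚ.* ε ℚ.+ 0ℚ               <⟨ ℚ.+-monoʳ-< (seq x n ℚ.+ ℚ.½ ℚ.* ε) (½-pos 0<ε) ⟩
    seq x n ℚ.+ ℚ.½ ℚ.* ε ℚ.+ ℚ.½ ℚ.* ε        ≡⟨ ℚ.+-assoc (seq x n) _ _ ⟩
    seq x n ℚ.+ (ℚ.½ ℚ.* ε ℚ.+ ℚ.½ ℚ.* ε)      ≡⟨ ≡.cong (seq x n ℚ.+_) (½+½ ε) ⟩
    seq x n ℚ.+ ε                              ≤⟨ p n (ℕ.m≤m⊔n M N) ⟩
    seq y n                                    ≤⟨ q n (ℕ.m≤n⊔m M N) ⟩
    seq x n ℚ.+ ℚ.½ ℚ.* ε                      ∎)

≤-stable : ∀ x y → ¬ ¬ (x ≤ y) → x ≤ y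
≤-stable x y x≤y = ≮⇒≥ y x λ y<x → x≤y (<⇒≱ y x y<x)

trichotomy : ∀ x → ¬ ¬ (x ≈ 0ℝ ⊎ 0ℝ < x ⊎ 0ℝ < - x)
trichotomy x h = h (inj₁ (≤-antisym x 0ℝ
  (≮⇒≥ 0ℝ x λ 0<x → h (inj₂ (inj₁ 0<x)))
  (≮⇒≥ x 0ℝ λ (ε , 0<ε , N , p) → h (inj₂ (inj₂ (ε , 0<ε , N , λ n b → begin
    0ℚ ℚ.+ ε                                 ≡⟨ ℚ.+-identityˡ ε ⟩
    ε                                        ≡⟨ ℚ-Solver.solve 2 (λ a e → e := (a :+ e) :- a) ≡.refl (seq x n) ε ⟩
    seq x n ℚ.+ ε ℚ.- seq x n                ≤⟨ ℚ.+-monoˡ-≤ (ℚ.- seq x n) (p n b) ⟩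
    0ℚ ℚ.- seq x n                           ≡⟨ ℚ.+-identityˡ _ ⟩
    ℚ.- seq x n                              ∎))))))

positive-unit : ∀ x → 0ℝ < x → ∃ λ y → x * y ≈ 1ℝ
positive-unit x (ε , 0<ε , N , p) = y , xy≈1
  where
  -- Terms before `N` may be zero or negative. The maximum with ε makes all of them invertible and
  -- changes nothing from `N` on; it also bounds every reciprocal by `D`, the reciprocal of ε.
  m : ℕ → ℚ
  m n = seq x n ℚ.⊔ ε

  0<m : ∀ n → 0ℚ ℚ.< m n
  0<m n = ℚ.<-≤-trans 0<ε (ℚ.p≤q⊔p (seq x n) ε)

  inverse : ∀ n → ∃ λ d → 0ℚ ℚ.< d × m n ℚ.* d ≡ 1ℚ
  inverse n = fraction (0<m n) (ℚ.positive⁻¹ 1ℚ)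

  d : ℕ → ℚ
  d n = proj₁ (inverse n)

  D : ℚ
  D = proj₁ (fraction 0<ε (ℚ.positive⁻¹ 1ℚ))

  d≤D : ∀ n → d n ℚ.≤ D
  d≤D n = let _ , 0<d , md≡1 = inverse n
              _ , 0<D , εD≡1 = fraction 0<ε (ℚ.positive⁻¹ 1ℚ) in begin
    d n                        ≡⟨ ℚ.*-identityˡ (d n) ⟨
    1ℚ ℚ.* d n                 ≡⟨ ≡.cong (ℚ._* d n) εD≡1 ⟨
    (ε ℚ.* D) ℚ.* d n          ≤⟨ ℚ.*-monoʳ-≤-nonNeg (d n) {{ℚ.nonNegative (ℚ.<⇒≤ 0<d)}}
                                    (ℚ.*-monoʳ-≤-nonNeg D {{ℚ.nonNegative (ℚ.<⇒≤ 0<D)}} (ℚ.p≤q⊔p (seq x n) ε)) ⟩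
    (m n ℚ.* D) ℚ.* d n        ≡⟨ ℚ-Solver.solve 3 (λ m D d → (m :* D) :* d := (m :* d) :* D) ≡.refl (m n) D (d n) ⟩
    (m n ℚ.* d n) ℚ.* D        ≡⟨ ≡.cong (ℚ._* D) md≡1 ⟩
    1ℚ ℚ.* D                   ≡⟨ ℚ.*-identityˡ D ⟩
    D                          ∎

  m≡x : ∀ n → N ℕ.≤ n → m n ≡ seq x n
  m≡x n b = ℚ.p≥q⇒p⊔q≡p (ℚ.≤-trans (ℚ.≤-reflexive (≡.sym (ℚ.+-identityˡ ε))) (p n b))

  -- The difference of two reciprocals is `d i * d j` times the difference `m j - m i`. The first
  -- factor is at most D², which dictates the tolerance `e` with D² e = η.
  d-cauchy : IsCauchy d
  d-cauchy η 0<η =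
    let _ , 0<D , _  = fraction 0<ε (ℚ.positive⁻¹ 1ℚ)
        0<DD         = ≡.subst (ℚ._< D ℚ.* D) (ℚ.*-zeroʳ D) (ℚ.*-monoʳ-<-pos D {{ℚ.positive 0<D}} 0<D)
        e , 0<e , DDe≡η = fraction 0<DD 0<η
        M , close    = cauchy x e 0<e
    in M ℕ.⊔ N , λ i j a b →
      let m-close = ≡.subst₂ (λ u v → ℚ.∣ u ℚ.- v ∣ ℚ.≤ e)
            (≡.sym (m≡x j (ℕ.m⊔n≤o⇒n≤o M N b))) (≡.sym (m≡x i (ℕ.m⊔n≤o⇒n≤o M N a)))
            (close j i (ℕ.m⊔n≤o⇒m≤o M N b) (ℕ.m⊔n≤o⇒m≤o M N a))
          _ , 0<dᵢ , mdᵢ≡1 = inverse i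
          _ , 0<dⱼ , mdⱼ≡1 = inverse j
          0≤dd = ≡.subst (ℚ._≤ d i ℚ.* d j) (ℚ.*-zeroʳ (d i)) (ℚ.*-monoˡ-≤-nonNeg (d i) {{ℚ.nonNegative (ℚ.<⇒≤ 0<dᵢ)}} (ℚ.<⇒≤ 0<dⱼ))
      in begin
        ℚ.∣ d i ℚ.- d j ∣
          ≡⟨ ≡.cong ℚ.∣_∣ (≡.cong₂ ℚ._-_ (≡.sym (≡.trans (≡.cong (d i ℚ.*_) mdⱼ≡1) (ℚ.*-identityʳ (d i))))
                                        (≡.sym (≡.trans (≡.cong (d j ℚ.*_) mdᵢ≡1) (ℚ.*-identityʳ (d j))))) ⟩
        ℚ.∣ d i ℚ.* (m j ℚ.* d j) ℚ.- d j ℚ.* (m i ℚ.* d i) ∣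
          ≡⟨ ≡.cong ℚ.∣_∣ (ℚ-Solver.solve 4 (λ a b u v → a :* (v :* b) :- b :* (u :* a) := (a :* b) :* (v :- u)) ≡.refl (d i) (d j) (m i) (m j)) ⟩
        ℚ.∣ (d i ℚ.* d j) ℚ.* (m j ℚ.- m i) ∣
          ≡⟨ ℚ.∣p*q∣≡∣p∣*∣q∣ (d i ℚ.* d j) _ ⟩
        ℚ.∣ d i ℚ.* d j ∣ ℚ.* ℚ.∣ m j ℚ.- m i ∣
          ≡⟨ ≡.cong (ℚ._* ℚ.∣ m j ℚ.- m i ∣) (ℚ.0≤p⇒∣p∣≡p 0≤dd) ⟩
        (d i ℚ.* d j) ℚ.* ℚ.∣ m j ℚ.- m i ∣
          ≤⟨ *-mono-≤-nonNeg (d i ℚ.* d j) (D ℚ.* D) ℚ.∣ m j ℚ.- m i ∣ e (ℚ.0≤∣p∣ _) (ℚ.<⇒≤ 0<DD)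
               (*-mono-≤-nonNeg (d i) D (d j) D (ℚ.<⇒≤ 0<dⱼ) (ℚ.<⇒≤ 0<D) (d≤D i) (d≤D j)) m-close ⟩
        (D ℚ.* D) ℚ.* e
          ≡⟨ DDe≡η ⟩
        η ∎

  y : ℝ
  y = mkℝ d d-cauchy

  xy≈1 : x * y ≈ 1ℝ
  xy≈1 η 0<η = N , λ n b → ≡.subst (λ q → ℚ.∣ q ∣ ℚ.≤ η)
    (≡.sym (≡.trans (≡.cong (ℚ._- 1ℚ) (≡.trans (≡.cong (ℚ._* d n) (≡.sym (m≡x n b))) (proj₂ (proj₂ (inverse n))))) (ℚ.+-inverseʳ 1ℚ)))
    (ℚ.<⇒≤ 0<η)

module ℝᶜ = CommutativeRing ℝ-commutativeRing

zero-or-unit : ∀ x → ¬ ¬ (x ≈ 0ℝ ⊎ ∃ λ y → x * y ≈ 1ℝ)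
zero-or-unit x = trichotomy x >>= λ where
  (inj₁ x≈0)        → return (inj₁ x≈0)
  (inj₂ (inj₁ 0<x)) → return (inj₂ (positive-unit x 0<x))
  (inj₂ (inj₂ x<0)) → let y , -xy≈1 = positive-unit (- x) x<0 in return (inj₂ (- y
    , ≈-trans (x * - y) (- x * y) 1ℝ
        (≗⇒≈ (x * - y) (- x * y) λ n → ℚ-Solver.solve 2 (λ a b → a :* (:- b) := (:- a) :* b) ≡.refl (seq x n) (seq y n))
        -xy≈1))

eventually-nonNeg : ∀ x → (∃ λ N → ∀ n → N ℕ.≤ n → 0ℚ ℚ.≤ seq x n) → 0ℝ ≤ x
eventually-nonNeg x (N , p) ε 0<ε = N , λ n b →
  ℚ.≤-trans (p n b) (≡.subst (ℚ._≤ seq x n ℚ.+ ε) (ℚ.+-identityʳ (seq x n)) (ℚ.+-monoʳ-≤ (seq x n) (ℚ.<⇒≤ 0<ε)))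

positive-seq : ∀ x → ((ε , _ , N , _) : 0ℝ < x) → ∀ n → N ℕ.≤ n → 0ℚ ℚ.≤ seq x n
positive-seq x (ε , 0<ε , N , p) n b = ℚ.≤-trans (ℚ.<⇒≤ 0<ε) (ℚ.≤-trans (ℚ.≤-reflexive (≡.sym (ℚ.+-identityˡ ε))) (p n b))

*-nonNegℚ : ∀ {p q} → 0ℚ ℚ.≤ p → 0ℚ ℚ.≤ q → 0ℚ ℚ.≤ p ℚ.* q
*-nonNegℚ {p} {q} 0≤p 0≤q = ≡.subst (ℚ._≤ p ℚ.* q) (ℚ.*-zeroʳ p) (ℚ.*-monoˡ-≤-nonNeg p {{ℚ.nonNegative 0≤p}} 0≤q)

nonNeg-cases : ∀ x → 0ℝ ≤ x → ¬ ¬ (x ≈ 0ℝ ⊎ 0ℝ < x)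
nonNeg-cases x 0≤x h = h (inj₁ (≤-antisym x 0ℝ (≮⇒≥ 0ℝ x (h ∘ inj₂)) 0≤x))

-- A nonnegative real may have negative terms tending to zero, so signs cannot be multiplied term by
-- term. Under double negation each factor is zero or positive, and positive reals have eventually
-- nonnegative terms.
*-nonNeg : ∀ x y → 0ℝ ≤ x → 0ℝ ≤ y → 0ℝ ≤ x * y
*-nonNeg x y 0≤x 0≤y = ≤-stable 0ℝ (x * y) (nonNeg-cases x 0≤x >>= λ where
  (inj₁ x≈0) → return (zero-product (x * y) (≈-trans (x * y) (0ℝ * y) 0ℝ (*-congʳ x 0ℝ y x≈0) (ℝᶜ.zeroˡ y)))
  (inj₂ 0<x@(_ , _ , M , _)) → nonNeg-cases y 0≤y >>= λ where
    (inj₁ y≈0) → return (zero-product (x * y) (≈-trans (x * y) (x * 0ℝ) 0ℝ (*-cong x x y 0ℝ (ℝᶜ.refl {x}) y≈0) (ℝᶜ.zeroʳ x)))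
    (inj₂ 0<y@(_ , _ , N , _)) → return (eventually-nonNeg (x * y) (M ℕ.⊔ N , λ n b →
      *-nonNegℚ (positive-seq x 0<x n (ℕ.m⊔n≤o⇒m≤o M N b)) (positive-seq y 0<y n (ℕ.m⊔n≤o⇒n≤o M N b)))))
  where
  zero-product : ∀ z → z ≈ 0ℝ → 0ℝ ≤ z
  zero-product z z≈0 = ≈⇒≤ 0ℝ z (≈-sym z 0ℝ z≈0)

square-nonNeg : ∀ x → 0ℝ ≤ x * x
square-nonNeg x = eventually-nonNeg (x * x) (0 , λ n _ → case n)
  where
  case : ∀ n → 0ℚ ℚ.≤ seq x n ℚ.* seq x n
  case n with ℚ.≤-total 0ℚ (seq x n)
  ... | inj₁ 0≤x = *-nonNegℚ 0≤x 0≤x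
  ... | inj₂ x≤0 = ≡.subst (0ℚ ℚ.≤_) (ℚ-Solver.solve 1 (λ a → (:- a) :* (:- a) := a :* a) ≡.refl (seq x n))
                     (*-nonNegℚ (ℚ.neg-antimono-≤ x≤0) (ℚ.neg-antimono-≤ x≤0))

ℝ-orderedAlgebra : OrderedAlgebra
ℝ-orderedAlgebra = record
  { commutativeRing  = ℝ-commutativeRing
  ; ℚ-algebra        = record
    { ⟦_⟧    = fromℚ
    ; +-homo = λ p q → ≗⇒≈ (fromℚ (p ℚ.+ q)) (fromℚ p + fromℚ q) λ _ → ≡.refl
    ; *-homo = λ p q → ≗⇒≈ (fromℚ (p ℚ.* q)) (fromℚ p * fromℚ q) λ _ → ≡.refl
    ; -‿homo = λ p → ≗⇒≈ (fromℚ (ℚ.- p)) (- fromℚ p) λ _ → ≡.refl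
    ; 0-homo = ℝᶜ.refl {0ℝ}
    ; 1-homo = ℝᶜ.refl {1ℝ}
    }
  ; _≤_              = _≤_
  ; ≤-isPartialOrder = record
    { isPreorder = record
      { isEquivalence = ℝᶜ.isEquivalence
      ; reflexive     = λ {x y} → ≈⇒≤ x y
      ; trans         = λ {x y z} → ≤-trans x y z
      }
    ; antisym = λ {x y} → ≤-antisym x y
    }
  ; +-mono-≤         = λ {x y z w} → +-mono-≤ x y z w
  ; *-nonNeg         = λ {x y} → *-nonNeg x y
  ; square-nonNeg    = square-nonNeg
  ; ≤-stable         = λ {x y} → ≤-stable x y
  ; 1≉0              = λ 1≈0 → <⇒≱ 0ℝ 1ℝ (1ℚ , ℚ.positive⁻¹ 1ℚ , 0 , λ _ _ → ℚ.≤-reflexive (ℚ.+-identityˡ 1ℚ)) (≈⇒≤ 1ℝ 0ℝ 1≈0)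
  ; zero-or-unit     = zero-or-unit
  }

-- Transfer of the bound to the given spectrum

module L = LinearAlgebra ℝ-orderedAlgebra
module Σ = CommutativeMonoidSum ℝᶜ.+-commutativeMonoid

-- Both are the same Laplace expansion, but `L.∑` is opaque, so the sums have to be identified at
-- every level of the recursion.
det≈det : ∀ {n} (M : Matrix n) → L.det M ≈ det M
det≈det {zero}  M = ℝᶜ.refl {1ℝ}
det≈det {suc n} M = ≈-trans (L.det M) (sum terms) (det M) (L.∑≈sum terms) (Σ.sum-cong-≋ {suc n} {terms} {terms′} λ j →
  *-cong (s j) (s j) (M zero j * L.det (L.minor M j)) (M zero j * det (L.minor M j)) (ℝᶜ.refl {s j})
    (*-cong (M zero j) (M zero j) (L.det (L.minor M j)) (det (L.minor M j)) (ℝᶜ.refl {M zero j}) (det≈det (L.minor M j))))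
  where
  s terms terms′ : Fin (suc n) → ℝ
  s j = (- 1ℝ) ^ toℕ j
  terms  j = s j * (M zero j * L.det (L.minor M j))
  terms′ j = s j * (M zero j * det (L.minor M j))

theorem5p4 : (n : ℕ) (G : Graph n) → Connected G →
    (α : ℝ) → 0ℝ ≤ α → α < 1ℝ →
    (k : ℕ) → 1 ℕ.≤ k → (k≤n : k ℕ.≤ n) →
    (U : Subset n) → ∣ U ∣ ≡ k ∸ 1 →
    (ev : Fin n → ℝ) → IsSpectrum (Aα G α) ev →
    (α - 1/ℕ (suc (n ∸ k))) * fromℕ (degreeSum G U)
    + (fromℕ (2 ℕ.* numEdges G) - (1ℝ - α) * fromℕ (length (∂ G U (∁ U)))) * 1/ℕ (suc (n ∸ k))
    ≤ S k≤n ev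
-- Matching the index as `suc k` turns `1 ≤ index ≤ n` into `k < n` and the required size of `U`
-- into `k`.
theorem5p4 n G _ α _ _ (suc k) _ k<n U ∣U∣≡k ev spectrum = ≤-trans bound (L.∑ top) (S k<n ev)
  (GraphBound.eigenvalue-sum-bound ℝ-orderedAlgebra G α k k<n U ∣U∣≡k ev descending λ t →
    ≈-trans (L.det (charMatrix t)) (charPoly (Aα G α) t) (product (λ i → t - ev i))
      (det≈det (charMatrix t)) (roots t))
  (≈⇒≤ (L.∑ top) (S k<n ev) (L.∑≈sum top))
  where
  open IsSpectrum spectrum
  bound : ℝ
  bound = (α - 1/ℕ (suc (n ∸ suc k))) * fromℕ (degreeSum G U)
    + (fromℕ (2 ℕ.* numEdges G) - (1ℝ - α) * fromℕ (length (∂ G U (∁ U)))) * 1/ℕ (suc (n ∸ suc k))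
  top : Fin (suc k) → ℝ
  top i = ev (inject≤ i k<n)
  charMatrix : ℝ → Matrix n
  charMatrix t i j = t * δ i j - Aα G α i j
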